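{- The following series identity holds: $$\sum_{k=0}^{\infty}\left(\frac{ -1}{4}\right)^k\frac{(1)_k^3(\frac{1}{2})_k}{(\frac{5}{4})_k^2(\frac{7}{4})_k^2}\left\{(19+56k+40k^2)\left[H_{k}^{(2)}+H_{1+2k}^{(2)}-4H_{3+4k}^{(2)}\right]+4\right\}=-72\beta(4).$$
   Context: For a complex number $x$ and a nonnegative integer $n$, the shifted factorial is $(x)_0=1$ and $(x)_n=x(x+1)\cdots(x+n-1)$ for $n\ge 1$; $(x)_n^m$ denotes $((x)_n)^m$. The harmonic numbers of order 2 are $H_n^{(2)}=\sum_{j=1}^n \frac{1}{j^2}$, with $H_0^{(2)}=0$. The constant $\beta(4)$ is $\beta(4)=\sum_{k=0}^{\infty}\frac{(-1)^k}{(1+2k)^4}$. -}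

module Defs where

open import Data.Integer as ℤ using (+_)
import Data.Integer.Properties as ℤ
open import Data.Nat as ℕ using (ℕ; zero; suc)
import Data.Nat.Properties as ℕ
open import Data.Sum using (inj₁; inj₂)
open import Data.Product using (∃-syntax; _,_; proj₁; proj₂)
open import Data.Rational
open import Data.Rational.Properties
open import Data.Rational.Solver using (module +-*-Solver)
import Data.Rational.Unnormalised as ℚᵘ
import Data.Rational.Unnormalised.Properties as ℚᵘ
open import Algebra.Definitions.RawSemiring +-*-rawSemiring public using (_^_)
open import Relation.Binary.PropositionalEquality

fromℕ : ℕ → ℚ
fromℕ n = + n / 1

∑< : ℕ → (ℕ → ℚ) → ℚ
∑< zero    a = 0ℚ
∑< (suc n) a = ∑< n a + a n

-- The shifted factorial (x)ₙ = x (x + 1) ⋯ (x + n - 1).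
poch : ℚ → ℕ → ℚ
poch x zero    = 1ℚ
poch x (suc n) = poch x n * (x + fromℕ n)

-- The index j of the summand is shifted down by one.
H⁽²⁾ : ℕ → ℚ
H⁽²⁾ n = ∑< n (λ j → (+ 1 / suc j) ^ 2)

^-pos : ∀ x .{{_ : Positive x}} n → Positive (x ^ n)
^-pos x zero    = _
^-pos x (suc n) = pos*pos⇒pos x (x ^ n) {{^-pos x n}}

fromℕ-nonNeg : ∀ n → NonNegative (fromℕ n)
fromℕ-nonNeg n = normalize-nonNeg n 1

poch-pos : ∀ x .{{_ : Positive x}} n → Positive (poch x n)
poch-pos x zero    = _
poch-pos x (suc n) =
  pos*pos⇒pos (poch x n) {{poch-pos x n}}
    (x + fromℕ n) {{pos+nonNeg⇒pos x (fromℕ n) {{fromℕ-nonNeg n}}}}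

denominator≢0 : ∀ k → NonZero (poch (+ 5 / 4) k ^ 2 * poch (+ 7 / 4) k ^ 2)
denominator≢0 k = pos⇒nonZero (u * v) {{pos*pos⇒pos u {{pu}} v {{pv}}}}
  where
  u  = poch (+ 5 / 4) k ^ 2
  v  = poch (+ 7 / 4) k ^ 2
  pu = ^-pos (poch (+ 5 / 4) k) {{poch-pos (+ 5 / 4) k}} 2
  pv = ^-pos (poch (+ 7 / 4) k) {{poch-pos (+ 7 / 4) k}} 2

IsCauchy : (ℕ → ℚ) → Set
IsCauchy s = ∀ ε → 0ℚ < ε →
  ∃[ N ] (∀ m n → N ℕ.≤ m → N ℕ.≤ n → ∣ s m - s n ∣ < ε)

-- Real numbers, as Cauchy sequences of rationals.
record ℝ : Set where
  constructor mkℝ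
  field
    seq    : ℕ → ℚ
    cauchy : IsCauchy seq

open ℝ public

private
  ½*-pos : ∀ ε → 0ℚ < ε → 0ℚ < ½ * ε
  ½*-pos ε 0<ε = positive⁻¹ (½ * ε) {{pos*pos⇒pos ½ ε {{positive 0<ε}}}}

  ½+½ : ∀ ε → ½ * ε + ½ * ε ≡ ε
  ½+½ = solve 1 (λ e → con ½ :* e :+ con ½ :* e := e) refl
    where open +-*-Solver

  ∣p∣-∣q∣≤∣p-q∣ : ∀ p q → ∣ p ∣ - ∣ q ∣ ≤ ∣ p - q ∣
  ∣p∣-∣q∣≤∣p-q∣ p q = begin
    ∣ p ∣ - ∣ q ∣                  ≡⟨ cong (λ r → ∣ r ∣ - ∣ q ∣) (split p q) ⟩
    ∣ (p - q) + q ∣ - ∣ q ∣        ≤⟨ +-monoˡ-≤ (- ∣ q ∣) (∣p+q∣≤∣p∣+∣q∣ (p - q) q) ⟩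
    (∣ p - q ∣ + ∣ q ∣) - ∣ q ∣    ≡⟨ cancel ∣ p - q ∣ ∣ q ∣ ⟩
    ∣ p - q ∣                      ∎
    where
    open ≤-Reasoning
    open +-*-Solver
    split : ∀ p q → p ≡ (p - q) + q
    split = solve 2 (λ p q → p := (p :- q) :+ q) refl
    cancel : ∀ a b → (a + b) - b ≡ a
    cancel = solve 2 (λ a b → (a :+ b) :- b := a) refl

  neg-sub : ∀ a b → - (a - b) ≡ b - a
  neg-sub = solve 2 (λ a b → :- (a :- b) := b :- a) refl
    where open +-*-Solver

  ∣-∣-sym : ∀ p q → ∣ p - q ∣ ≡ ∣ q - p ∣
  ∣-∣-sym p q = trans (sym (∣-p∣≡∣p∣ (p - q))) (cong ∣_∣ (neg-sub p q))

  ∣∣p∣-∣q∣∣≤∣p-q∣ : ∀ p q → ∣ ∣ p ∣ - ∣ q ∣ ∣ ≤ ∣ p - q ∣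
  ∣∣p∣-∣q∣∣≤∣p-q∣ p q with ∣p∣≡p∨∣p∣≡-p (∣ p ∣ - ∣ q ∣)
  ... | inj₁ eq = subst (_≤ ∣ p - q ∣) (sym eq) (∣p∣-∣q∣≤∣p-q∣ p q)
  ... | inj₂ eq = subst₂ _≤_ (sym (trans eq (neg-sub ∣ p ∣ ∣ q ∣))) (∣-∣-sym q p)
                    (∣p∣-∣q∣≤∣p-q∣ q p)

  +-cauchy : ∀ s t → IsCauchy s → IsCauchy t → IsCauchy (λ n → s n + t n)
  +-cauchy s t cs ct ε 0<ε = M ℕ.⊔ N , λ m n M⊔N≤m M⊔N≤n → begin-strict
    ∣ (s m + t m) - (s n + t n) ∣
      ≡⟨ cong ∣_∣ (swap (s m) (t m) (s n) (t n)) ⟩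
    ∣ (s m - s n) + (t m - t n) ∣
      ≤⟨ ∣p+q∣≤∣p∣+∣q∣ (s m - s n) (t m - t n) ⟩
    ∣ s m - s n ∣ + ∣ t m - t n ∣
      <⟨ +-mono-< (proj₂ (cs _ 0<½ε) m n (left M⊔N≤m) (left M⊔N≤n))
                  (proj₂ (ct _ 0<½ε) m n (right M⊔N≤m) (right M⊔N≤n)) ⟩
    ½ * ε + ½ * ε
      ≡⟨ ½+½ ε ⟩
    ε ∎
    where
    open ≤-Reasoning
    open +-*-Solver
    0<½ε = ½*-pos ε 0<ε
    M = proj₁ (cs _ 0<½ε)
    N = proj₁ (ct _ 0<½ε)
    left : ∀ {k} → M ℕ.⊔ N ℕ.≤ k → M ℕ.≤ k
    left = ℕ.≤-trans (ℕ.m≤m⊔n M N)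
    right : ∀ {k} → M ℕ.⊔ N ℕ.≤ k → N ℕ.≤ k
    right = ℕ.≤-trans (ℕ.m≤n⊔m M N)
    swap : ∀ a b c d → (a + b) - (c + d) ≡ (a - c) + (b - d)
    swap = solve 4 (λ a b c d → (a :+ b) :- (c :+ d) := (a :- c) :+ (b :- d)) refl

  *-cauchy : ∀ c s → IsCauchy s → IsCauchy (λ n → c * s n)
  *-cauchy c s cs ε 0<ε = proj₁ (cs δ 0<δ) , λ m n N≤m N≤n → begin-strict
    ∣ c * s m - c * s n ∣      ≡⟨ cong ∣_∣ (factor c (s m) (s n)) ⟩
    ∣ c * (s m - s n) ∣        ≡⟨ ∣p*q∣≡∣p∣*∣q∣ c (s m - s n) ⟩
    ∣ c ∣ * ∣ s m - s n ∣      ≤⟨ *-monoʳ-≤-nonNeg ∣ s m - s n ∣ {{∣-∣-nonNeg (s m - s n)}} ∣c∣≤b ⟩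
    b * ∣ s m - s n ∣          <⟨ *-monoʳ-<-pos b {{b>0}} (proj₂ (cs δ 0<δ) m n N≤m N≤n) ⟩
    b * (b⁻¹ * ε)              ≡⟨ sym (*-assoc b b⁻¹ ε) ⟩
    b * b⁻¹ * ε                ≡⟨ cong (_* ε) (*-inverseʳ b {{pos⇒nonZero b {{b>0}}}}) ⟩
    1ℚ * ε                     ≡⟨ *-identityˡ ε ⟩
    ε                          ∎
    where
    open ≤-Reasoning
    open +-*-Solver
    b = 1ℚ + ∣ c ∣
    b>0 : Positive b
    b>0 = pos+nonNeg⇒pos 1ℚ ∣ c ∣ {{∣-∣-nonNeg c}}
    b⁻¹ = (1/ b) {{pos⇒nonZero b {{b>0}}}}
    δ = b⁻¹ * ε
    0<δ : 0ℚ < δ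
    0<δ = positive⁻¹ δ {{pos*pos⇒pos b⁻¹ {{1/pos⇒pos b {{b>0}}}} ε {{positive 0<ε}}}}
    ∣c∣≤b : ∣ c ∣ ≤ b
    ∣c∣≤b = subst (_≤ b) (+-identityˡ ∣ c ∣) (+-monoˡ-≤ ∣ c ∣ (<⇒≤ (positive⁻¹ 1ℚ)))
    factor : ∀ c x y → c * x - c * y ≡ c * (x - y)
    factor = solve 3 (λ c x y → c :* x :- c :* y := c :* (x :- y)) refl

fromℚ : ℚ → ℝ
fromℚ q .seq    _       = q
fromℚ q .cauchy ε 0<ε = 0 , λ _ _ _ _ → subst (λ r → ∣ r ∣ < ε) (sym (+-inverseʳ q)) 0<ε

infixl 6 _+ᵣ_ _-ᵣ_
infixr 7 _·ᵣ_
infix  4 _≤ᵣ_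

_+ᵣ_ : ℝ → ℝ → ℝ
(x +ᵣ y) .seq n  = seq x n + seq y n
(x +ᵣ y) .cauchy = +-cauchy (seq x) (seq y) (cauchy x) (cauchy y)

_·ᵣ_ : ℚ → ℝ → ℝ
(c ·ᵣ x) .seq n  = c * seq x n
(c ·ᵣ x) .cauchy = *-cauchy c (seq x) (cauchy x)

_-ᵣ_ : ℝ → ℝ → ℝ
x -ᵣ y = x +ᵣ (- 1ℚ) ·ᵣ y

∣_∣ᵣ : ℝ → ℝ
∣ x ∣ᵣ .seq n = ∣ seq x n ∣
∣ x ∣ᵣ .cauchy ε 0<ε = proj₁ (cauchy x ε 0<ε) , λ m n N≤m N≤n →
  ≤-<-trans (∣∣p∣-∣q∣∣≤∣p-q∣ (seq x m) (seq x n)) (proj₂ (cauchy x ε 0<ε) m n N≤m N≤n)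

-- A termwise comparison would depend on the representing sequences, hence the slack ε.
_≤ᵣ_ : ℝ → ℝ → Set
x ≤ᵣ y = ∀ ε → 0ℚ < ε → ∃[ N ] (∀ n → N ℕ.≤ n → seq x n ≤ seq y n + ε)

infix 4 _SumsTo_

-- The series a 0 + a 1 + a 2 + ⋯ converges in ℝ, with sum x.
_SumsTo_ : (ℕ → ℚ) → ℝ → Set
a SumsTo x = ∀ ε → 0ℚ < ε →
  ∃[ N ] (∀ n → N ℕ.≤ n → ∣ fromℚ (∑< n a) -ᵣ x ∣ᵣ ≤ᵣ fromℚ ε)

β4-term : ℕ → ℚ
β4-term k = (- 1ℚ) ^ k * (+ 1 / (1 ℕ.+ 2 ℕ.* k)) ^ 4

private
  inv : ℕ → ℚ
  inv n = + 1 / suc n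

  inv-pos : ∀ n → Positive (inv n)
  inv-pos n = normalize-pos 1 (suc n)

  toℚᵘ-inv : ∀ n → toℚᵘ (inv n) ℚᵘ.≃ ℚᵘ.mkℚᵘ (+ 1) n
  toℚᵘ-inv n = toℚᵘ-fromℚᵘ (ℚᵘ.mkℚᵘ (+ 1) n)

  inv-mono : ∀ {m n} → m ℕ.≤ n → inv n ≤ inv m
  inv-mono {m} {n} m≤n = toℚᵘ-cancel-≤ (begin
    toℚᵘ (inv n)          ≃⟨ toℚᵘ-inv n ⟩
    ℚᵘ.mkℚᵘ (+ 1) n       ≤⟨ ℚᵘ.*≤* (ℤ.*-monoˡ-≤-nonNeg (+ 1) (ℤ.+≤+ (ℕ.s≤s m≤n))) ⟩
    ℚᵘ.mkℚᵘ (+ 1) m       ≃⟨ ℚᵘ.≃-sym (toℚᵘ-inv m) ⟩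
    toℚᵘ (inv m)          ∎)
    where open ℚᵘ.≤-Reasoning

  inv-small : ∀ ε → 0ℚ < ε → ∃[ N ] inv N < ε
  inv-small (mkℚ (+ zero)    d _) 0<ε with positive 0<ε
  ... | ()
  inv-small (mkℚ ℤ.-[1+ a ] d _) 0<ε with positive 0<ε
  ... | ()
  inv-small ε@(mkℚ ℤ.+[1+ a ] d _) 0<ε = suc d , toℚᵘ-cancel-< (begin-strict
    toℚᵘ (inv (suc d))       ≃⟨ toℚᵘ-inv (suc d) ⟩
    ℚᵘ.mkℚᵘ (+ 1) (suc d)    <⟨ ℚᵘ.*<* (ℤ.+<+ 1·d<a·d) ⟩
    toℚᵘ ε                   ∎)
    where
    open ℚᵘ.≤-Reasoning
    1·d<a·d : 1 ℕ.* suc d ℕ.< suc a ℕ.* suc (suc d)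
    1·d<a·d = ℕ.*-mono-≤ {1} {suc a} (ℕ.s≤s ℕ.z≤n) ℕ.≤-refl

  inv-inverse : ∀ n → fromℕ (suc n) * inv n ≡ 1ℚ
  inv-inverse n = toℚᵘ-injective (begin-equality
    toℚᵘ (fromℕ (suc n) * inv n)
      ≃⟨ toℚᵘ-homo-* (fromℕ (suc n)) (inv n) ⟩
    toℚᵘ (fromℕ (suc n)) ℚᵘ.* toℚᵘ (inv n)
      ≃⟨ ℚᵘ.*-cong (toℚᵘ-fromℚᵘ (ℚᵘ.mkℚᵘ (+ suc n) 0)) (toℚᵘ-inv n) ⟩
    ℚᵘ.mkℚᵘ (+ suc n) 0 ℚᵘ.* ℚᵘ.mkℚᵘ (+ 1) n
      ≃⟨ ℚᵘ.*-inverseʳ (ℚᵘ.mkℚᵘ (+ suc n) 0) ⟩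
    toℚᵘ 1ℚ ∎)
    where open ℚᵘ.≤-Reasoning

  fromℕ-suc : ∀ n → fromℕ (suc n) ≡ 1ℚ + fromℕ n
  fromℕ-suc n = toℚᵘ-injective (begin-equality
    toℚᵘ (fromℕ (suc n))
      ≃⟨ toℚᵘ-fromℚᵘ (ℚᵘ.mkℚᵘ (+ suc n) 0) ⟩
    ℚᵘ.mkℚᵘ (+ suc n) 0
      ≃⟨ ℚᵘ.*≡* (cong (ℤ._* (+ 1)) (cong (λ x → (+ 1) ℤ.+ x) (sym (ℤ.*-identityʳ (+ n))))) ⟩
    toℚᵘ 1ℚ ℚᵘ.+ ℚᵘ.mkℚᵘ (+ n) 0
      ≃⟨ ℚᵘ.+-congʳ (toℚᵘ 1ℚ) (ℚᵘ.≃-sym (toℚᵘ-fromℚᵘ (ℚᵘ.mkℚᵘ (+ n) 0))) ⟩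
    toℚᵘ 1ℚ ℚᵘ.+ toℚᵘ (fromℕ n)
      ≃⟨ ℚᵘ.≃-sym (toℚᵘ-homo-+ 1ℚ (fromℕ n)) ⟩
    toℚᵘ (1ℚ + fromℕ n) ∎)
    where open ℚᵘ.≤-Reasoning

  inv-step : ∀ n → inv n ≡ inv (suc n) + inv n * inv (suc n)
  inv-step n = begin
    p                          ≡⟨ sym (*-identityʳ p) ⟩
    p * 1ℚ                     ≡⟨ cong (p *_) (sym (inv-inverse (suc n))) ⟩
    p * (fromℕ (2 ℕ.+ n) * q)  ≡⟨ cong (λ x → p * (x * q)) (fromℕ-suc (suc n)) ⟩
    p * ((1ℚ + a) * q)         ≡⟨ expand p a q ⟩
    (a * p) * q + p * q        ≡⟨ cong (λ x → x * q + p * q) (inv-inverse n) ⟩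
    1ℚ * q + p * q             ≡⟨ cong (_+ p * q) (*-identityˡ q) ⟩
    q + p * q                  ∎
    where
    open ≡-Reasoning
    open +-*-Solver
    p = inv n
    q = inv (suc n)
    a = fromℕ (suc n)
    expand : ∀ p a q → p * ((1ℚ + a) * q) ≡ (a * p) * q + p * q
    expand = solve 3 (λ p a q → p :* ((con 1ℚ :+ a) :* q) := (a :* p) :* q :+ p :* q) refl

  *-mono-nonNeg : ∀ {a b c d} → 0ℚ ≤ a → 0ℚ ≤ d → a ≤ b → c ≤ d → a * c ≤ b * d
  *-mono-nonNeg {a} {b} {c} {d} 0≤a 0≤d a≤b c≤d =
    ≤-trans (*-monoˡ-≤-nonNeg a {{nonNegative 0≤a}} c≤d)
            (*-monoʳ-≤-nonNeg d {{nonNegative 0≤d}} a≤b)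

  inv-nonneg : ∀ n → 0ℚ ≤ inv n
  inv-nonneg n = <⇒≤ (positive⁻¹ (inv n) {{inv-pos n}})

  inv²≤ : ∀ n → inv n * inv n + (inv (suc n) + inv (suc n)) ≤ inv n + inv n
  inv²≤ n = begin
    p * p + (q + q)            ≤⟨ +-monoˡ-≤ (q + q) (*-monoˡ-≤-nonNeg p {{nonNegative (inv-nonneg n)}} p≤q+q) ⟩
    p * (q + q) + (q + q)      ≡⟨ regroup p q ⟩
    (q + p * q) + (q + p * q)  ≡⟨ sym (cong₂ _+_ (inv-step n) (inv-step n)) ⟩
    p + p                      ∎
    where
    open ≤-Reasoning
    open +-*-Solver
    p = inv n
    q = inv (suc n)
    regroup : ∀ p q → p * (q + q) + (q + q) ≡ (q + p * q) + (q + p * q)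
    regroup = solve 2 (λ p q → p :* (q :+ q) :+ (q :+ q) := (q :+ p :* q) :+ (q :+ p :* q)) refl
    p*q≤q : p * q ≤ q
    p*q≤q = subst (p * q ≤_) (*-identityˡ q)
      (*-monoʳ-≤-nonNeg q {{nonNegative (inv-nonneg (suc n))}} (inv-mono {0} {n} ℕ.z≤n))
    p≤q+q : p ≤ q + q
    p≤q+q = subst (_≤ q + q) (sym (inv-step n)) (+-monoʳ-≤ q p*q≤q)

  ∣-1^n∣≡1 : ∀ n → ∣ (- 1ℚ) ^ n ∣ ≡ 1ℚ
  ∣-1^n∣≡1 zero    = refl
  ∣-1^n∣≡1 (suc n) = trans (∣p*q∣≡∣p∣*∣q∣ (- 1ℚ) ((- 1ℚ) ^ n)) (cong (1ℚ *_) (∣-1^n∣≡1 n))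

  fourth : ∀ x → x ^ 4 ≡ (x * x) * (x * x)
  fourth = solve 1 (λ x → x :* (x :* (x :* (x :* con 1ℚ))) := (x :* x) :* (x :* x)) refl
    where open +-*-Solver

  ∣β4-term∣≤ : ∀ k → ∣ β4-term k ∣ ≤ inv k * inv k
  ∣β4-term∣≤ k = begin
    ∣ (- 1ℚ) ^ k * r ^ 4 ∣        ≡⟨ ∣p*q∣≡∣p∣*∣q∣ ((- 1ℚ) ^ k) (r ^ 4) ⟩
    ∣ (- 1ℚ) ^ k ∣ * ∣ r ^ 4 ∣    ≡⟨ cong (_* ∣ r ^ 4 ∣) (∣-1^n∣≡1 k) ⟩
    1ℚ * ∣ r ^ 4 ∣                ≡⟨ *-identityˡ ∣ r ^ 4 ∣ ⟩
    ∣ r ^ 4 ∣                     ≡⟨ cong ∣_∣ (fourth r) ⟩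
    ∣ (r * r) * (r * r) ∣         ≡⟨ 0≤p⇒∣p∣≡p (nonneg* 0≤r² 0≤r²) ⟩
    (r * r) * (r * r)             ≤⟨ *-mono-nonNeg 0≤r² (<⇒≤ (positive⁻¹ 1ℚ)) r²≤p² r²≤1 ⟩
    (p * p) * 1ℚ                  ≡⟨ *-identityʳ (p * p) ⟩
    p * p                         ∎
    where
    open ≤-Reasoning
    r = inv (2 ℕ.* k)
    p = inv k
    0≤r = inv-nonneg (2 ℕ.* k)
    0≤p = inv-nonneg k
    nonneg* : ∀ {x y} → 0ℚ ≤ x → 0ℚ ≤ y → 0ℚ ≤ x * y
    nonneg* {x} {y} 0≤x 0≤y = subst (_≤ x * y) (*-zeroʳ x) (*-monoˡ-≤-nonNeg x {{nonNegative 0≤x}} 0≤y)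
    0≤r² = nonneg* 0≤r 0≤r
    r≤p : r ≤ p
    r≤p = inv-mono {k} {2 ℕ.* k} (ℕ.m≤m+n k (k ℕ.+ 0))
    r≤1 : r ≤ 1ℚ
    r≤1 = inv-mono {0} {2 ℕ.* k} ℕ.z≤n
    r²≤p² = *-mono-nonNeg 0≤r 0≤p r≤p r≤p
    r²≤1 = *-mono-nonNeg 0≤r (<⇒≤ (positive⁻¹ 1ℚ)) r≤1 r≤1

  tail : ∀ N d → ∣ ∑< (d ℕ.+ N) β4-term - ∑< N β4-term ∣ + (inv (d ℕ.+ N) + inv (d ℕ.+ N)) ≤ inv N + inv N
  tail N zero = ≤-reflexive (trans
    (cong (λ x → ∣ x ∣ + (inv N + inv N)) (+-inverseʳ (∑< N β4-term)))
    (+-identityˡ (inv N + inv N)))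
  tail N (suc d) = begin
    ∣ (S + t) - S₀ ∣ + (q + q)              ≡⟨ cong (λ x → ∣ x ∣ + (q + q)) (swap S t S₀) ⟩
    ∣ (S - S₀) + t ∣ + (q + q)              ≤⟨ +-monoˡ-≤ (q + q) (∣p+q∣≤∣p∣+∣q∣ (S - S₀) t) ⟩
    (∣ S - S₀ ∣ + ∣ t ∣) + (q + q)          ≤⟨ +-monoˡ-≤ (q + q) (+-monoʳ-≤ ∣ S - S₀ ∣ (∣β4-term∣≤ (d ℕ.+ N))) ⟩
    (∣ S - S₀ ∣ + p * p) + (q + q)          ≡⟨ +-assoc ∣ S - S₀ ∣ (p * p) (q + q) ⟩
    ∣ S - S₀ ∣ + (p * p + (q + q))          ≤⟨ +-monoʳ-≤ ∣ S - S₀ ∣ (inv²≤ (d ℕ.+ N)) ⟩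
    ∣ S - S₀ ∣ + (p + p)                    ≤⟨ tail N d ⟩
    inv N + inv N                           ∎
    where
    open ≤-Reasoning
    open +-*-Solver
    S  = ∑< (d ℕ.+ N) β4-term
    S₀ = ∑< N β4-term
    t  = β4-term (d ℕ.+ N)
    p  = inv (d ℕ.+ N)
    q  = inv (suc (d ℕ.+ N))
    swap : ∀ a b c → (a + b) - c ≡ (a - c) + b
    swap = solve 3 (λ a b c → (a :+ b) :- c := (a :- c) :+ b) refl

  tail′ : ∀ {N n} → N ℕ.≤ n → ∣ ∑< n β4-term - ∑< N β4-term ∣ ≤ inv N + inv N
  tail′ {N} {n} N≤n = subst (λ j → ∣ ∑< j β4-term - ∑< N β4-term ∣ ≤ inv N + inv N) (ℕ.m∸n+n≡m N≤n)
    (≤-trans (p≤p+q₁ _ (inv j + inv j) (+-mono-≤ (inv-nonneg j) (inv-nonneg j))) (tail N (n ℕ.∸ N)))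
    where
    j = n ℕ.∸ N ℕ.+ N
    p≤p+q₁ : ∀ p q → 0ℚ ≤ q → p ≤ p + q
    p≤p+q₁ p q 0≤q = subst (_≤ p + q) (+-identityʳ p) (+-monoʳ-≤ p 0≤q)

β4-cauchy : IsCauchy (λ n → ∑< n β4-term)
β4-cauchy ε 0<ε = N , λ m n N≤m N≤n → begin-strict
  ∣ S m - S n ∣                        ≡⟨ cong ∣_∣ (split (S m) (S n) (S N)) ⟩
  ∣ (S m - S N) - (S n - S N) ∣        ≤⟨ ∣p-q∣≤∣p∣+∣q∣ (S m - S N) (S n - S N) ⟩
  ∣ S m - S N ∣ + ∣ S n - S N ∣        ≤⟨ +-mono-≤ (tail′ N≤m) (tail′ N≤n) ⟩
  (inv N + inv N) + (inv N + inv N)    <⟨ +-mono-< 2inv<½ε 2inv<½ε ⟩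
  ½ * ε + ½ * ε                        ≡⟨ ½+½ ε ⟩
  ε                                    ∎
  where
  open ≤-Reasoning
  open +-*-Solver
  S : ℕ → ℚ
  S n = ∑< n β4-term
  small = inv-small (½ * (½ * ε)) (½*-pos (½ * ε) (½*-pos ε 0<ε))
  N = proj₁ small
  2inv<½ε : inv N + inv N < ½ * ε
  2inv<½ε = subst (inv N + inv N <_) (½+½ (½ * ε)) (+-mono-< (proj₂ small) (proj₂ small))
  split : ∀ a b c → a - b ≡ (a - c) - (b - c)
  split = solve 3 (λ a b c → a :- b := (a :- c) :- (b :- c)) refl

-- β(4) = ∑ₖ (-1)ᵏ / (1 + 2k)⁴, given by the partial sums of its defining series.
β4 : ℝ
β4 = mkℝ (λ n → ∑< n β4-term) β4-cauchy

{-# OPTIONS --safe #-}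
module Submission where

-- Put A(n) = (n + ½)² − y.  With r(k) = − (2k + 2) (2k + 1) ((k + 1)² − y) and c(k + 1) = r(k) c(k), the function
--   F(n,k) = (−1)ⁿ c(k) / (A(n) A(n + 1) ⋯ A(n + 2k))
-- has a WZ mate G(n,k) = (−1)ⁿ c(k) Q(n,k) / (A(n) ⋯ A(n + 2k + 1)) with Q quadratic in n, so that
-- F(n,k+1) − F(n,k) = G(n+1,k) − G(n,k).  Summing over n and k turns ∑ₙ (−1)ⁿ / A(n) into the fast series ∑ₖ G(0,k),
-- and the coefficient of y¹ of that acceleration formula is the identity for β(4).  Below, F and G are these
-- coefficients, normalised so that F(n,0) and G(0,k) are exactly the terms of − 72 β(4) and of the series.
-- The double sum over n < M, k < K leaves the boundary terms ∑ₙ F(n,K) = O(1/K), uniformly in M, and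
-- ∑ₖ G(M,k) = O(1/M) for each fixed K.

open import Defs
open import Data.Integer as ℤ using (+_)
import Data.Integer.Properties as ℤ
open import Data.Nat as ℕ using (ℕ; zero; suc)
import Data.Nat.Properties as ℕ
open import Data.Product using (∃-syntax; _,_; proj₁; proj₂)
open import Data.Rational
open import Data.Rational.Properties
open import Data.Rational.Solver using (module +-*-Solver)
import Data.Rational.Unnormalised as ℚᵘ
import Data.Rational.Unnormalised.Properties as ℚᵘ
open import Relation.Binary.PropositionalEquality

open +-*-Solver

-- Arithmetic of natural numbers and their reciprocals inside ℚ

fromℚᵘ-homo-+ : ∀ p q → fromℚᵘ (p ℚᵘ.+ q) ≡ fromℚᵘ p + fromℚᵘ q
fromℚᵘ-homo-+ p q = toℚᵘ-injective (begin-equality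
  toℚᵘ (fromℚᵘ (p ℚᵘ.+ q))                  ≃⟨ toℚᵘ-fromℚᵘ (p ℚᵘ.+ q) ⟩
  p ℚᵘ.+ q                                  ≃⟨ ℚᵘ.+-cong (toℚᵘ-fromℚᵘ p) (toℚᵘ-fromℚᵘ q) ⟨
  toℚᵘ (fromℚᵘ p) ℚᵘ.+ toℚᵘ (fromℚᵘ q)      ≃⟨ toℚᵘ-homo-+ (fromℚᵘ p) (fromℚᵘ q) ⟨
  toℚᵘ (fromℚᵘ p + fromℚᵘ q)                ∎)
  where open ℚᵘ.≤-Reasoning

fromℚᵘ-homo-* : ∀ p q → fromℚᵘ (p ℚᵘ.* q) ≡ fromℚᵘ p * fromℚᵘ q
fromℚᵘ-homo-* p q = toℚᵘ-injective (begin-equality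
  toℚᵘ (fromℚᵘ (p ℚᵘ.* q))                  ≃⟨ toℚᵘ-fromℚᵘ (p ℚᵘ.* q) ⟩
  p ℚᵘ.* q                                  ≃⟨ ℚᵘ.*-cong (toℚᵘ-fromℚᵘ p) (toℚᵘ-fromℚᵘ q) ⟨
  toℚᵘ (fromℚᵘ p) ℚᵘ.* toℚᵘ (fromℚᵘ q)      ≃⟨ toℚᵘ-homo-* (fromℚᵘ p) (fromℚᵘ q) ⟨
  toℚᵘ (fromℚᵘ p * fromℚᵘ q)                ∎)
  where open ℚᵘ.≤-Reasoning

-- The device for clearing denominators: products such as `b n * (o n * o n)`, known to be 1, are
-- inserted into or removed from an expression, so that the ring solver only ever meets polynomials.
*-unitʳ : ∀ x {y} → y ≡ 1ℚ → x * y ≡ x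
*-unitʳ x refl = *-identityʳ x

fromℕ-+ : ∀ m n → fromℕ (m ℕ.+ n) ≡ fromℕ m + fromℕ n
fromℕ-+ m n = trans
  (fromℚᵘ-cong {ℚᵘ.mkℚᵘ (+ (m ℕ.+ n)) 0} {ℚᵘ.mkℚᵘ (+ m) 0 ℚᵘ.+ ℚᵘ.mkℚᵘ (+ n) 0}
    (ℚᵘ.*≡* (cong (ℤ._* + 1) (sym (cong₂ ℤ._+_ (ℤ.*-identityʳ (+ m)) (ℤ.*-identityʳ (+ n)))))))
  (fromℚᵘ-homo-+ (ℚᵘ.mkℚᵘ (+ m) 0) (ℚᵘ.mkℚᵘ (+ n) 0))

fromℕ-suc : ∀ n → fromℕ (suc n) ≡ 1ℚ + fromℕ n
fromℕ-suc = fromℕ-+ 1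

fromℕ-2* : ∀ n → fromℕ (2 ℕ.* n) ≡ fromℕ 2 * fromℕ n
fromℕ-2* n = begin
  fromℕ (n ℕ.+ (n ℕ.+ 0))        ≡⟨ cong (λ m → fromℕ (n ℕ.+ m)) (ℕ.+-identityʳ n) ⟩
  fromℕ (n ℕ.+ n)                ≡⟨ fromℕ-+ n n ⟩
  fromℕ n + fromℕ n              ≡⟨ solve 1 (λ x → x :+ x := con (fromℕ 2) :* x) refl (fromℕ n) ⟩
  fromℕ 2 * fromℕ n              ∎
  where open ≡-Reasoning

fromℕ-inverse : ∀ n → (+ 1 / suc n) * fromℕ (suc n) ≡ 1ℚ
fromℕ-inverse n = trans
  (sym (fromℚᵘ-homo-* (ℚᵘ.mkℚᵘ (+ 1) n) (ℚᵘ.mkℚᵘ (+ suc n) 0)))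
  (fromℚᵘ-cong (ℚᵘ.*-inverseˡ (ℚᵘ.mkℚᵘ (+ suc n) 0)))

inv : ℕ → ℚ
inv n = + 1 / suc n

-- `o n` is the odd number 2n + 1 and `w n` its reciprocal, so `b n` is 1 / (4 A(n)) at y = 0.
w o b : ℕ → ℚ
w n = inv (2 ℕ.* n)
o n = 1ℚ + fromℕ 2 * fromℕ n
b n = w n * w n

inv*suc : ∀ n → inv n * (1ℚ + fromℕ n) ≡ 1ℚ
inv*suc n = trans (cong (inv n *_) (sym (fromℕ-suc n))) (fromℕ-inverse n)

w*o : ∀ n → w n * o n ≡ 1ℚ
w*o n = trans (cong (λ x → w n * (1ℚ + x)) (sym (fromℕ-2* n))) (inv*suc (2 ℕ.* n))

square-inverse : ∀ x y → x * y ≡ 1ℚ → (x * x) * (y * y) ≡ 1ℚ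
square-inverse x y xy≡1 = begin
  (x * x) * (y * y)    ≡⟨ solve 2 (λ x y → (x :* x) :* (y :* y) := (x :* y) :* (x :* y)) refl x y ⟩
  (x * y) * (x * y)    ≡⟨ cong₂ _*_ xy≡1 xy≡1 ⟩
  1ℚ                   ∎
  where open ≡-Reasoning

b*o² : ∀ n → b n * (o n * o n) ≡ 1ℚ
b*o² n = square-inverse (w n) (o n) (w*o n)

o-+ : ∀ m n → o (m ℕ.+ n) ≡ o n + fromℕ 2 * fromℕ m
o-+ m n = trans (cong (λ x → 1ℚ + fromℕ 2 * x) (fromℕ-+ m n))
  (solve 2 (λ x y → con 1ℚ :+ con (fromℕ 2) :* (x :+ y)
                  := (con 1ℚ :+ con (fromℕ 2) :* y) :+ con (fromℕ 2) :* x)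
     refl (fromℕ m) (fromℕ n))

-- Writes the odd number belonging to the index a + 2k + n as a polynomial in `o n` and `fromℕ k`,
-- the two variables in which the certificates are checked.
b*o²-shift : ∀ a k n → let y = o n + fromℕ 2 * (fromℕ a + fromℕ 2 * fromℕ k) in
             b (a ℕ.+ 2 ℕ.* k ℕ.+ n) * (y * y) ≡ 1ℚ
b*o²-shift a k n = trans (cong (λ y → b m * (y * y)) (sym o≡)) (b*o² m)
  where
  m = a ℕ.+ 2 ℕ.* k ℕ.+ n
  o≡ : o m ≡ o n + fromℕ 2 * (fromℕ a + fromℕ 2 * fromℕ k)
  o≡ = trans (o-+ (a ℕ.+ 2 ℕ.* k) n)
    (cong (λ z → o n + fromℕ 2 * z) (trans (fromℕ-+ a (2 ℕ.* k)) (cong (λ z → fromℕ a + z) (fromℕ-2* k))))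

-- Products and sums over windows of consecutive odd numbers

∏b ∑b : ℕ → ℕ → ℚ
∏b n zero    = 1ℚ
∏b n (suc l) = ∏b n l * b (l ℕ.+ n)
∑b n l       = ∑< l (λ i → b (i ℕ.+ n))

-- The recursion peels off the last factor. Peeling off the first one as well lets windows starting
-- at n and at n + 1 be compared through their common interior.
∏b-front : ∀ n l → ∏b n (suc l) ≡ b n * ∏b (suc n) l
∏b-front n zero    = *-comm 1ℚ (b n)
∏b-front n (suc l) = begin
  ∏b n (suc l) * b (suc l ℕ.+ n)             ≡⟨ cong₂ _*_ (∏b-front n l) (cong b (sym (ℕ.+-suc l n))) ⟩
  (b n * ∏b (suc n) l) * b (l ℕ.+ suc n)     ≡⟨ *-assoc (b n) (∏b (suc n) l) (b (l ℕ.+ suc n)) ⟩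
  b n * ∏b (suc n) (suc l)                   ∎
  where open ≡-Reasoning

∑b-front : ∀ n l → ∑b n (suc l) ≡ b n + ∑b (suc n) l
∑b-front n zero    = +-comm 0ℚ (b n)
∑b-front n (suc l) = begin
  ∑b n (suc l) + b (suc l ℕ.+ n)             ≡⟨ cong₂ _+_ (∑b-front n l) (cong b (sym (ℕ.+-suc l n))) ⟩
  (b n + ∑b (suc n) l) + b (l ℕ.+ suc n)     ≡⟨ +-assoc (b n) (∑b (suc n) l) (b (l ℕ.+ suc n)) ⟩
  b n + ∑b (suc n) (suc l)                   ∎
  where open ≡-Reasoning

-- The WZ pair

±1 : ℕ → ℚ
±1 n = (- 1ℚ) ^ n

-- This is - 16 r(k) at y = 0: raising k by one adds two factors 1 / A to the window, and each of
-- them equals 4 `b`. The sign goes into `±1 k` in `c`.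
ratio : ℕ → ℚ
ratio k = fromℕ 32 * ((1ℚ + fromℕ k) * ((1ℚ + fromℕ k) * (1ℚ + fromℕ k))) * (1ℚ + fromℕ 2 * fromℕ k)

-- The value 72 and the overall minus sign in `c` give `F n 0` the factor - 72 of the right-hand
-- side.
C c : ℕ → ℚ
C zero    = fromℕ 72
C (suc k) = ratio k * C k
c k = - (±1 k * C k)

-- Solves the WZ equation for G / F; q 0 k is half of 19 + 56 k + 40 k².
q : ℕ → ℕ → ℚ
q n k = ½ * (o n * o n + fromℕ 6 * (1ℚ + fromℕ 2 * fromℕ k) * o n
             + fromℕ 2 * (1ℚ + fromℕ 2 * fromℕ k) * (fromℕ 6 + fromℕ 10 * fromℕ k))

-- The logarithmic derivative at y = 0 of c(k) / ∏ A(n + i), in the scale 4y.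
L : ℕ → ℕ → ℕ → ℚ
L n l k = ∑b n l - (+ 1 / 4) * H⁽²⁾ k

-- Both come from the product rule in the variable 4y. In `G` the numerator Q depends on y too: its
-- value at 0 is `q n k`, and its coefficient of 4y is - ½.
F G : ℕ → ℕ → ℚ
F n k = ±1 n * c k * ∏b n (1 ℕ.+ 2 ℕ.* k) * L n (1 ℕ.+ 2 ℕ.* k) k
G n k = ±1 n * c k * ∏b n (2 ℕ.+ 2 ℕ.* k) * (q n k * L n (2 ℕ.+ 2 ℕ.* k) k - ½)

-- All four terms share the interior window `p` of indices n + 1, ..., n + 2k: `F n k` has the
-- product `b₀ * p`, `G n k` has `b₀ * p * b₁`, `G (suc n) k` has `p * b₁ * b₂`, and `F n (suc k)`
-- has `b₀ * p * b₁ * b₂`. The squares `X`, `Y`, `Z` are the inverses of `b₀`, `b₁`, `b₂`, and `κ`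
-- is what the harmonic part of `L` loses when k grows by one.
module WZ-identity (n k : ℕ) where
  open ≡-Reasoning
  x t κ b₀ b₁ b₂ X Y Z q₀ q₁ r ρ p ℓ s : ℚ
  x  = o n
  t  = fromℕ k
  κ  = (+ 1 / 4) * (inv k) ^ 2
  b₀ = b n
  b₁ = b (1 ℕ.+ 2 ℕ.* k ℕ.+ n)
  b₂ = b (2 ℕ.+ 2 ℕ.* k ℕ.+ n)
  X  = x * x
  Y  = (x + fromℕ 2 * (1ℚ + fromℕ 2 * t)) * (x + fromℕ 2 * (1ℚ + fromℕ 2 * t))
  Z  = (x + fromℕ 2 * (fromℕ 2 + fromℕ 2 * t)) * (x + fromℕ 2 * (fromℕ 2 + fromℕ 2 * t))
  q₀ = q n k
  q₁ = q (suc n) k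
  r  = ratio k
  ρ  = fromℕ 8 * (1ℚ + t) * (1ℚ + fromℕ 2 * t)
  p  = ∏b (suc n) (2 ℕ.* k)
  ℓ  = L (suc n) (2 ℕ.* k) k
  s  = ±1 n

  b₀X : b₀ * X ≡ 1ℚ
  b₀X = b*o² n

  b₁Y : b₁ * Y ≡ 1ℚ
  b₁Y = b*o²-shift 1 k n

  b₂Z : b₂ * Z ≡ 1ℚ
  b₂Z = b*o²-shift 2 k n

  -- The square (k + 1)² in the denominator of `κ` cancels against the cube in `ratio k`. In the
  -- scale 4y, `ρ` is minus the derivative of 16 times the y-dependent - r(k).
  rκ≡ρ : r * κ ≡ ρ
  rκ≡ρ = begin
    r * κ
      ≡⟨ solve 3 (λ i u v → con (fromℕ 32) :* (u :* (u :* u)) :* v :* (con (+ 1 / 4) :* (i :* (i :* con 1ℚ)))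
                     := con (fromℕ 8) :* u :* v :* ((i :* u) :* (i :* u)))
               refl (inv k) (1ℚ + t) (1ℚ + fromℕ 2 * t) ⟩
    ρ * ((inv k * (1ℚ + t)) * (inv k * (1ℚ + t)))
      ≡⟨ cong (ρ *_) (cong₂ _*_ (inv*suc k) (inv*suc k)) ⟩
    ρ * 1ℚ
      ≡⟨ *-identityʳ ρ ⟩
    ρ ∎

  q₁≡ : q₁ ≡ ½ * ((x + fromℕ 2) * (x + fromℕ 2) + fromℕ 6 * (1ℚ + fromℕ 2 * t) * (x + fromℕ 2)
             + fromℕ 2 * (1ℚ + fromℕ 2 * t) * (fromℕ 6 + fromℕ 10 * t))
  q₁≡ = cong (λ z → ½ * (z * z + fromℕ 6 * (1ℚ + fromℕ 2 * t) * z
             + fromℕ 2 * (1ℚ + fromℕ 2 * t) * (fromℕ 6 + fromℕ 10 * t))) (o-+ 1 n)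

  -- The WZ equation at y = 0, and below it the coefficient of y of the WZ equation, with denominators cleared.
  certificate : r ≡ Z * q₀ + X * q₁ - Y * Z
  certificate = trans
    (solve 2 (λ x t →
       let q x = con ½ :* (x :* x :+ con (fromℕ 6) :* (con 1ℚ :+ con (fromℕ 2) :* t) :* x
                  :+ con (fromℕ 2) :* (con 1ℚ :+ con (fromℕ 2) :* t) :* (con (fromℕ 6) :+ con (fromℕ 10) :* t))
           y = x :+ con (fromℕ 2) :* (con 1ℚ :+ con (fromℕ 2) :* t)
           z = x :+ con (fromℕ 2) :* (con (fromℕ 2) :+ con (fromℕ 2) :* t)
           u = con 1ℚ :+ t
       in con (fromℕ 32) :* (u :* (u :* u)) :* (con 1ℚ :+ con (fromℕ 2) :* t)
          := (z :* z) :* q x :+ (x :* x) :* q (x :+ con (fromℕ 2)) :- (y :* y) :* (z :* z)) refl x t)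
    (cong (λ z → Z * q₀ + X * z - Y * Z) (sym q₁≡))

  certificate′ : Z + Y + ρ ≡ q₀ + q₁ + ½ * X + ½ * Z
  certificate′ = trans
    (solve 2 (λ x t →
       let q x = con ½ :* (x :* x :+ con (fromℕ 6) :* (con 1ℚ :+ con (fromℕ 2) :* t) :* x
                  :+ con (fromℕ 2) :* (con 1ℚ :+ con (fromℕ 2) :* t) :* (con (fromℕ 6) :+ con (fromℕ 10) :* t))
           y = x :+ con (fromℕ 2) :* (con 1ℚ :+ con (fromℕ 2) :* t)
           z = x :+ con (fromℕ 2) :* (con (fromℕ 2) :+ con (fromℕ 2) :* t)
       in z :* z :+ y :* y :+ con (fromℕ 8) :* (con 1ℚ :+ t) :* (con 1ℚ :+ con (fromℕ 2) :* t)
          := q x :+ q (x :+ con (fromℕ 2)) :+ con ½ :* (x :* x) :+ con ½ :* (z :* z)) refl x t)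
    (cong (λ z → q₀ + z + ½ * X + ½ * Z) (sym q₁≡))

  Σ g₀ g₁ β : ℚ
  Σ  = ℓ + b₀ + b₁ + b₂
  g₀ = q₀ * (ℓ + b₀ + b₁) - ½
  g₁ = q₁ * (ℓ + b₁ + b₂) - ½
  β  = s * c k * p * (b₀ * b₁ * b₂)

  -- The WZ equation with the common factor `β` removed. Replacing `r` by `certificate` makes all
  -- terms in `ℓ` agree; once each product of some `b` with its square is set to 1, the remainder is
  -- the difference of the two sides of `certificate′`.
  bracket : Z * g₀ - r * (Σ - κ) ≡ Y * Z * (ℓ + b₀) - X * g₁
  bracket = begin
    Z * g₀ - r * (Σ - κ)
      ≡⟨ solve 5 (λ z g r σ κ → z :* g :- r :* (σ :- κ) := z :* g :- r :* σ :+ r :* κ) refl Z g₀ r Σ κ ⟩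
    Z * g₀ - r * Σ + r * κ
      ≡⟨ cong₂ (λ u v → Z * g₀ - u * Σ + v) certificate rκ≡ρ ⟩
    Z * g₀ - (Z * q₀ + X * q₁ - Y * Z) * Σ + ρ
      ≡⟨ solve 10 (λ X Y Z q₀ q₁ ρ ℓ b₀ b₁ b₂ →
           Z :* (q₀ :* (ℓ :+ b₀ :+ b₁) :- con ½) :- (Z :* q₀ :+ X :* q₁ :- Y :* Z) :* (ℓ :+ b₀ :+ b₁ :+ b₂) :+ ρ
           := (Y :* Z :* (ℓ :+ b₀) :- X :* (q₁ :* (ℓ :+ b₁ :+ b₂) :- con ½))
              :+ ((Z :* (b₁ :* Y) :+ Y :* (b₂ :* Z) :+ ρ)
                  :- (q₀ :* (b₂ :* Z) :+ q₁ :* (b₀ :* X) :+ con ½ :* X :+ con ½ :* Z)))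
           refl X Y Z q₀ q₁ ρ ℓ b₀ b₁ b₂ ⟩
    R + ((Z * (b₁ * Y) + Y * (b₂ * Z) + ρ) - (q₀ * (b₂ * Z) + q₁ * (b₀ * X) + ½ * X + ½ * Z))
      ≡⟨ cong₂ (λ u v → R + ((Z * u + Y * v + ρ) - (q₀ * v + q₁ * (b₀ * X) + ½ * X + ½ * Z))) b₁Y b₂Z ⟩
    R + ((Z * 1ℚ + Y * 1ℚ + ρ) - (q₀ * 1ℚ + q₁ * (b₀ * X) + ½ * X + ½ * Z))
      ≡⟨ cong (λ u → R + ((Z * 1ℚ + Y * 1ℚ + ρ) - (q₀ * 1ℚ + q₁ * u + ½ * X + ½ * Z))) b₀X ⟩
    R + ((Z * 1ℚ + Y * 1ℚ + ρ) - (q₀ * 1ℚ + q₁ * 1ℚ + ½ * X + ½ * Z))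
      ≡⟨ solve 7 (λ R X Y Z q₀ q₁ ρ →
           R :+ ((Z :* con 1ℚ :+ Y :* con 1ℚ :+ ρ) :- (q₀ :* con 1ℚ :+ q₁ :* con 1ℚ :+ con ½ :* X :+ con ½ :* Z))
           := R :+ ((Z :+ Y :+ ρ) :- (q₀ :+ q₁ :+ con ½ :* X :+ con ½ :* Z))) refl R X Y Z q₀ q₁ ρ ⟩
    R + ((Z + Y + ρ) - D)
      ≡⟨ cong (λ u → R + (u - D)) certificate′ ⟩
    R + (D - D)
      ≡⟨ solve 2 (λ R D → R :+ (D :- D) := R) refl R D ⟩
    R ∎
    where
    R D : ℚ
    R = Y * Z * (ℓ + b₀) - X * g₁
    D = q₀ + q₁ + ½ * X + ½ * Z

  2[1+k] : 2 ℕ.* suc k ≡ 2 ℕ.+ 2 ℕ.* k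
  2[1+k] = ℕ.*-suc 2 k

  c-suc : c (suc k) ≡ - (r * c k)
  c-suc = solve 3 (λ s r C → :- ((:- con 1ℚ :* s) :* (r :* C)) := :- (r :* :- (s :* C))) refl (±1 k) r (C k)

  L-front : ∀ l → L n (suc l) k ≡ L (suc n) l k + b₀
  L-front l = trans (cong (λ z → z - (+ 1 / 4) * H⁽²⁾ k) (∑b-front n l))
    (solve 3 (λ b s h → (b :+ s) :- h := (s :- h) :+ b) refl b₀ (∑b (suc n) l) ((+ 1 / 4) * H⁽²⁾ k))

  L-back : ∀ l m → L m (suc l) k ≡ L m l k + b (l ℕ.+ m)
  L-back l m = solve 3 (λ b s h → (s :+ b) :- h := (s :- h) :+ b) refl (b (l ℕ.+ m)) (∑b m l) ((+ 1 / 4) * H⁽²⁾ k)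

  F≡ : F n k ≡ s * c k * (b₀ * p) * (ℓ + b₀)
  F≡ = cong₂ (λ u v → s * c k * u * v) (∏b-front n (2 ℕ.* k)) (L-front (2 ℕ.* k))

  G≡ : G n k ≡ s * c k * (b₀ * p * b₁) * g₀
  G≡ = cong₂ (λ u v → s * c k * u * (q₀ * v - ½)) (cong (_* b₁) (∏b-front n (2 ℕ.* k)))
    (trans (L-back (1 ℕ.+ 2 ℕ.* k) n) (cong (_+ b₁) (L-front (2 ℕ.* k))))

  b₁-shift : b (2 ℕ.* k ℕ.+ suc n) ≡ b₁
  b₁-shift = cong b (ℕ.+-suc (2 ℕ.* k) n)

  b₂-shift : b (1 ℕ.+ 2 ℕ.* k ℕ.+ suc n) ≡ b₂
  b₂-shift = cong b (ℕ.+-suc (1 ℕ.+ 2 ℕ.* k) n)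

  G-suc≡ : G (suc n) k ≡ (- 1ℚ * s) * c k * (p * b₁ * b₂) * g₁
  G-suc≡ = cong₂ (λ u v → (- 1ℚ * s) * c k * u * (q₁ * v - ½))
    (cong₂ (λ u v → p * u * v) b₁-shift b₂-shift)
    (trans (L-back (1 ℕ.+ 2 ℕ.* k) (suc n))
      (cong₂ _+_ (trans (L-back (2 ℕ.* k) (suc n)) (cong (λ z → ℓ + z) b₁-shift)) b₂-shift))

  F-suc≡ : F n (suc k) ≡ s * - (r * c k) * (b₀ * p * b₁ * b₂) * (Σ - κ)
  F-suc≡ = trans
    (cong (λ m → s * c (suc k) * ∏b n (suc m) * L n (suc m) (suc k)) 2[1+k])
    (cong₃ (λ u v z → s * u * v * z) c-suc
      (cong (λ z → z * b₁ * b₂) (∏b-front n (2 ℕ.* k)))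
      L≡)
    where
    cong₃ : ∀ (f : ℚ → ℚ → ℚ → ℚ) {x x′ y y′ z z′} → x ≡ x′ → y ≡ y′ → z ≡ z′ → f x y z ≡ f x′ y′ z′
    cong₃ f refl refl refl = refl
    L≡ : L n (3 ℕ.+ 2 ℕ.* k) (suc k) ≡ Σ - κ
    L≡ = begin
      ((∑b n (1 ℕ.+ 2 ℕ.* k) + b₁) + b₂) - (+ 1 / 4) * (H⁽²⁾ k + (inv k) ^ 2)
        ≡⟨ solve 5 (λ σ b₁ b₂ h i → ((σ :+ b₁) :+ b₂) :- con (+ 1 / 4) :* (h :+ i)
                       := ((σ :- con (+ 1 / 4) :* h) :+ b₁ :+ b₂) :- con (+ 1 / 4) :* i)
             refl (∑b n (1 ℕ.+ 2 ℕ.* k)) b₁ b₂ (H⁽²⁾ k) ((inv k) ^ 2) ⟩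
      (L n (1 ℕ.+ 2 ℕ.* k) k + b₁ + b₂) - κ
        ≡⟨ cong (λ z → (z + b₁ + b₂) - κ) (L-front (2 ℕ.* k)) ⟩
      Σ - κ ∎

  identity : F n (suc k) + G n k ≡ F n k + G (suc n) k
  identity = begin
    F n (suc k) + G n k
      -- `G n k` is the term on this side without the factor `b₂`; inserting `b₂ * Z`, which is 1,
      -- makes `β` a common factor.
      ≡⟨ cong₂ _+_ F-suc≡ (trans G≡ (sym (*-unitʳ (s * c k * (b₀ * p * b₁) * g₀) b₂Z))) ⟩
    s * - (r * c k) * (b₀ * p * b₁ * b₂) * (Σ - κ) + s * c k * (b₀ * p * b₁) * g₀ * (b₂ * Z)
      ≡⟨ solve 12 (λ s r c p b₀ b₁ b₂ σ g₀ X Y Z →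
           s :* :- (r :* c) :* (b₀ :* p :* b₁ :* b₂) :* σ :+ s :* c :* (b₀ :* p :* b₁) :* g₀ :* (b₂ :* Z)
           := s :* c :* p :* (b₀ :* b₁ :* b₂) :* (Z :* g₀ :- r :* σ))
           refl s r (c k) p b₀ b₁ b₂ (Σ - κ) g₀ X Y Z ⟩
    β * (Z * g₀ - r * (Σ - κ))
      ≡⟨ cong (β *_) bracket ⟩
    β * (Y * Z * (ℓ + b₀) - X * g₁)
      ≡⟨ solve 11 (λ s c p b₀ b₁ b₂ σ g₁ X Y Z →
           s :* c :* p :* (b₀ :* b₁ :* b₂) :* (Y :* Z :* σ :- X :* g₁)
           := s :* c :* (b₀ :* p) :* σ :* ((b₁ :* Y) :* (b₂ :* Z)) :+ (:- con 1ℚ :* s) :* c :* (p :* b₁ :* b₂) :* g₁ :* (b₀ :* X))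
           refl s (c k) p b₀ b₁ b₂ (ℓ + b₀) g₁ X Y Z ⟩
    s * c k * (b₀ * p) * (ℓ + b₀) * ((b₁ * Y) * (b₂ * Z)) + (- 1ℚ * s) * c k * (p * b₁ * b₂) * g₁ * (b₀ * X)
      ≡⟨ cong₂ _+_ (*-unitʳ (s * c k * (b₀ * p) * (ℓ + b₀)) (cong₂ _*_ b₁Y b₂Z))
                   (*-unitʳ ((- 1ℚ * s) * c k * (p * b₁ * b₂) * g₁) b₀X) ⟩
    s * c k * (b₀ * p) * (ℓ + b₀) + (- 1ℚ * s) * c k * (p * b₁ * b₂) * g₁
      ≡⟨ cong₂ _+_ F≡ G-suc≡ ⟨
    F n k + G (suc n) k ∎

open WZ-identity using () renaming (identity to WZ)

-- Telescoping the WZ equation over a rectangle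

∑F-step : ∀ M k → ∑< M (λ n → F n (suc k)) + G 0 k ≡ ∑< M (λ n → F n k) + G M k
∑F-step zero    k = refl
∑F-step (suc M) k = begin
  (A + F M (suc k)) + G 0 k      ≡⟨ solve 3 (λ a f g → (a :+ f) :+ g := (a :+ g) :+ f) refl A (F M (suc k)) (G 0 k) ⟩
  (A + G 0 k) + F M (suc k)      ≡⟨ cong (_+ F M (suc k)) (∑F-step M k) ⟩
  (B + G M k) + F M (suc k)      ≡⟨ solve 3 (λ b g f → (b :+ g) :+ f := b :+ (f :+ g)) refl B (G M k) (F M (suc k)) ⟩
  B + (F M (suc k) + G M k)      ≡⟨ cong (λ z → B + z) (WZ M k) ⟩
  B + (F M k + G (suc M) k)      ≡⟨ +-assoc B (F M k) (G (suc M) k) ⟨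
  (B + F M k) + G (suc M) k      ∎
  where
  open ≡-Reasoning
  A = ∑< M (λ n → F n (suc k))
  B = ∑< M (λ n → F n k)

-- `∑F-step` has already telescoped `G` in n; adding it up over k telescopes `F` in k, and only the
-- four edges of the rectangle remain.
∑F-∑G : ∀ M K → ∑< M (λ n → F n K) + ∑< K (G 0) ≡ ∑< M (λ n → F n 0) + ∑< K (G M)
∑F-∑G M zero    = refl
∑F-∑G M (suc K) = begin
  A + (B + G 0 K)      ≡⟨ solve 3 (λ a b g → a :+ (b :+ g) := (a :+ g) :+ b) refl A B (G 0 K) ⟩
  (A + G 0 K) + B      ≡⟨ cong (_+ B) (∑F-step M K) ⟩
  (D + G M K) + B      ≡⟨ solve 3 (λ d g b → (d :+ g) :+ b := (d :+ b) :+ g) refl D (G M K) B ⟩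
  (D + B) + G M K      ≡⟨ cong (_+ G M K) (∑F-∑G M K) ⟩
  (E + H) + G M K      ≡⟨ +-assoc E H (G M K) ⟩
  E + (H + G M K)      ∎
  where
  open ≡-Reasoning
  A = ∑< M (λ n → F n (suc K))
  B = ∑< K (G 0)
  D = ∑< M (λ n → F n K)
  E = ∑< M (λ n → F n 0)
  H = ∑< K (G M)

-- The edges k = 0 and n = 0 as the two series of the theorem

∑<-cong : ∀ {f g : ℕ → ℚ} → (∀ n → f n ≡ g n) → ∀ n → ∑< n f ≡ ∑< n g
∑<-cong f≡g zero    = refl
∑<-cong f≡g (suc n) = cong₂ _+_ (∑<-cong f≡g n) (f≡g n)

∑<-*ˡ : ∀ a f n → ∑< n (λ i → a * f i) ≡ a * ∑< n f
∑<-*ˡ a f zero    = sym (*-zeroʳ a)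
∑<-*ˡ a f (suc n) = trans (cong (_+ a * f n) (∑<-*ˡ a f n)) (sym (*-distribˡ-+ a (∑< n f) (f n)))

-- At k = 0 the window has length one and the harmonic part is empty, so `L` reduces to `b n` and
-- `b n * b n` is the fourth power in β(4).
F₀≡β4-term : ∀ n → F n 0 ≡ (- fromℕ 72) * β4-term n
F₀≡β4-term n = solve 2 (λ s w →
    s :* con (c 0) :* (con 1ℚ :* (w :* w)) :* ((con 0ℚ :+ w :* w) :- con (+ 1 / 4) :* con 0ℚ)
    := con (- fromℕ 72) :* (s :* (w :* (w :* (w :* (w :* con 1ℚ)))))) refl (±1 n) (w n)

-- Splits the sum by the parity of the denominators: an even one contributes 1/(2j)², a quarter of
-- 1/j², and an odd one contributes a value of `b`.
H⁽²⁾-double : ∀ m → fromℕ 4 * H⁽²⁾ (2 ℕ.* m) ≡ H⁽²⁾ m + fromℕ 4 * ∑< m b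
H⁽²⁾-double zero    = refl
H⁽²⁾-double (suc m) = begin
  fromℕ 4 * H⁽²⁾ (2 ℕ.* suc m)
    ≡⟨ cong (λ l → fromℕ 4 * H⁽²⁾ l) (ℕ.*-suc 2 m) ⟩
  fromℕ 4 * ((H⁽²⁾ (2 ℕ.* m) + (w m) ^ 2) + j ^ 2)
    ≡⟨ solve 3 (λ h w j → con (fromℕ 4) :* ((h :+ w :* (w :* con 1ℚ)) :+ j :* (j :* con 1ℚ))
                := con (fromℕ 4) :* h :+ con (fromℕ 4) :* (w :* w) :+ (con (fromℕ 2) :* j) :* (con (fromℕ 2) :* j))
       refl (H⁽²⁾ (2 ℕ.* m)) (w m) j ⟩
  fromℕ 4 * H⁽²⁾ (2 ℕ.* m) + fromℕ 4 * b m + (fromℕ 2 * j) * (fromℕ 2 * j)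
    ≡⟨ cong₂ (λ u v → u + fromℕ 4 * b m + v * v) (H⁽²⁾-double m) 2j≡i ⟩
  (H⁽²⁾ m + fromℕ 4 * ∑< m b) + fromℕ 4 * b m + i * i
    ≡⟨ solve 4 (λ h s b i → (h :+ con (fromℕ 4) :* s) :+ con (fromℕ 4) :* b :+ i :* i
                := (h :+ i :* (i :* con 1ℚ)) :+ con (fromℕ 4) :* (s :+ b)) refl (H⁽²⁾ m) (∑< m b) (b m) i ⟩
  (H⁽²⁾ m + i ^ 2) + fromℕ 4 * (∑< m b + b m) ∎
  where
  open ≡-Reasoning
  i = inv m
  j = inv (suc (2 ℕ.* m))
  2j≡i : fromℕ 2 * j ≡ i
  2j≡i = begin
    fromℕ 2 * j                                     ≡⟨ *-unitʳ (fromℕ 2 * j) (inv*suc m) ⟨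
    fromℕ 2 * j * (i * (1ℚ + fromℕ m))              ≡⟨ solve 3 (λ j i m → con (fromℕ 2) :* j :* (i :* (con 1ℚ :+ m))
                                                         := i :* (j :* (con 1ℚ :+ (con 1ℚ :+ con (fromℕ 2) :* m)))) refl j i (fromℕ m) ⟩
    i * (j * (1ℚ + (1ℚ + fromℕ 2 * fromℕ m)))       ≡⟨ *-unitʳ i (trans (cong (λ z → j * (1ℚ + z))
                                                         (trans (cong (λ z → 1ℚ + z) (sym (fromℕ-2* m))) (sym (fromℕ-suc (2 ℕ.* m)))))
                                                         (inv*suc (suc (2 ℕ.* m)))) ⟩
    i                                               ∎

∑b₀ : ∀ l → ∑b 0 l ≡ ∑< l b
∑b₀ = ∑<-cong (λ i → cong b (ℕ.+-identityʳ i))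

-- With m = 1 + 2k the last index is 2m + 1. Doubling turns four times that harmonic number into
-- `H⁽²⁾ m` plus four times a sum of `b`, and `H⁽²⁾ m` cancels the middle term.
H⁽²⁾-bracket : ∀ k → H⁽²⁾ k + H⁽²⁾ (1 ℕ.+ 2 ℕ.* k) - fromℕ 4 * H⁽²⁾ (3 ℕ.+ 4 ℕ.* k)
             ≡ - fromℕ 4 * L 0 (2 ℕ.+ 2 ℕ.* k) k
H⁽²⁾-bracket k = begin
  h + h′ - fromℕ 4 * H⁽²⁾ (3 ℕ.+ 4 ℕ.* k)
    ≡⟨ cong (λ l → h + h′ - fromℕ 4 * H⁽²⁾ l) 3+4k ⟩
  h + h′ - fromℕ 4 * (H⁽²⁾ (2 ℕ.* m) + (w m) ^ 2)
    ≡⟨ solve 4 (λ h h′ H w → h :+ h′ :- con (fromℕ 4) :* (H :+ w :* (w :* con 1ℚ))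
                := h :+ h′ :- (con (fromℕ 4) :* H :+ con (fromℕ 4) :* (w :* w))) refl h h′ (H⁽²⁾ (2 ℕ.* m)) (w m) ⟩
  h + h′ - (fromℕ 4 * H⁽²⁾ (2 ℕ.* m) + fromℕ 4 * b m)
    ≡⟨ cong (λ z → h + h′ - (z + fromℕ 4 * b m)) (H⁽²⁾-double m) ⟩
  h + h′ - ((h′ + fromℕ 4 * ∑< m b) + fromℕ 4 * b m)
    ≡⟨ solve 4 (λ h h′ s b → h :+ h′ :- ((h′ :+ con (fromℕ 4) :* s) :+ con (fromℕ 4) :* b)
                := (:- con (fromℕ 4)) :* ((s :+ b) :- con (+ 1 / 4) :* h)) refl h h′ (∑< m b) (b m) ⟩
  - fromℕ 4 * (∑< (suc m) b - (+ 1 / 4) * h)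
    ≡⟨ cong (λ z → - fromℕ 4 * (z - (+ 1 / 4) * h)) (∑b₀ (suc m)) ⟨
  - fromℕ 4 * L 0 (suc m) k ∎
  where
  open ≡-Reasoning
  m = 1 ℕ.+ 2 ℕ.* k
  h = H⁽²⁾ k
  h′ = H⁽²⁾ m
  3+4k : 3 ℕ.+ 4 ℕ.* k ≡ suc (2 ℕ.* m)
  3+4k = cong suc (trans (cong (λ l → 2 ℕ.+ l) (ℕ.*-assoc 2 2 k)) (sym (ℕ.*-suc 2 (2 ℕ.* k))))

num den : ℕ → ℚ
num k = poch 1ℚ k ^ 3 * poch ½ k
den k = poch (+ 5 / 4) k ^ 2 * poch (+ 7 / 4) k ^ 2

-- Induction on k by comparing consecutive quotients. At k = 0 the left side is 72/8 times `b 1`,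
-- that is 1.
coeff-den : ∀ k → (+ 1 / 8) * (±1 k * C k) * ∏b 0 (2 ℕ.+ 2 ℕ.* k) * den k ≡ (- (+ 1 / 4)) ^ k * num k
coeff-den zero    = refl
coeff-den (suc k) = begin
  (+ 1 / 8) * ((- 1ℚ * ±1 k) * (ratio k * C k)) * ∏b 0 (2 ℕ.+ 2 ℕ.* suc k) * den (suc k)
    ≡⟨ cong (λ l → (+ 1 / 8) * ((- 1ℚ * ±1 k) * (ratio k * C k)) * ∏b 0 (2 ℕ.+ l) * den (suc k)) (ℕ.*-suc 2 k) ⟩
  (+ 1 / 8) * ((- 1ℚ * ±1 k) * (ratio k * C k)) * (E * b₂ * b₃) * den (suc k)
    -- The new window factors belong to the odd numbers 4k + 5 and 4k + 7, which are 4 (5/4 + k) and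
    -- 4 (7/4 + k). They cancel the new factors of `den`, leaving - 32 · 2 / 16², which is the - 1/4
    -- of the series.
    ≡⟨ solve 8 (λ s C E b₂ b₃ u v t →
         con (+ 1 / 8) :* ((:- con 1ℚ :* s)
           :* (con (fromℕ 32) :* ((con 1ℚ :+ t) :* ((con 1ℚ :+ t) :* (con 1ℚ :+ t))) :* (con 1ℚ :+ con (fromℕ 2) :* t) :* C))
           :* (E :* b₂ :* b₃)
           :* (((u :* (con (+ 5 / 4) :+ t)) :* ((u :* (con (+ 5 / 4) :+ t)) :* con 1ℚ))
               :* ((v :* (con (+ 7 / 4) :+ t)) :* ((v :* (con (+ 7 / 4) :+ t)) :* con 1ℚ)))
         := (con (+ 1 / 8) :* (s :* C) :* E :* ((u :* (u :* con 1ℚ)) :* (v :* (v :* con 1ℚ))))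
            :* (con (- (+ 1 / 4)) :* ((con 1ℚ :+ t) :* ((con 1ℚ :+ t) :* (con 1ℚ :+ t)) :* (con ½ :+ t)))
            :* ((b₂ :* ((con 1ℚ :+ con (fromℕ 2) :* (con (fromℕ 2) :+ con (fromℕ 2) :* t))
                        :* (con 1ℚ :+ con (fromℕ 2) :* (con (fromℕ 2) :+ con (fromℕ 2) :* t))))
                :* (b₃ :* ((con 1ℚ :+ con (fromℕ 2) :* (con (fromℕ 3) :+ con (fromℕ 2) :* t))
                        :* (con 1ℚ :+ con (fromℕ 2) :* (con (fromℕ 3) :+ con (fromℕ 2) :* t))))))
         refl (±1 k) (C k) E b₂ b₃ (poch (+ 5 / 4) k) (poch (+ 7 / 4) k) t ⟩
  (T * den k) * ρ * ((b₂ * (y₂ * y₂)) * (b₃ * (y₃ * y₃)))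
    ≡⟨ *-unitʳ ((T * den k) * ρ) (cong₂ _*_ (b*o²-shift 2 k 0) (b*o²-shift 3 k 0)) ⟩
  (T * den k) * ρ
    ≡⟨ cong (_* ρ) (coeff-den k) ⟩
  ((- (+ 1 / 4)) ^ k * num k) * ρ
    ≡⟨ solve 4 (λ e p h t →
         (e :* ((p :* (p :* (p :* con 1ℚ))) :* h))
           :* (con (- (+ 1 / 4)) :* ((con 1ℚ :+ t) :* ((con 1ℚ :+ t) :* (con 1ℚ :+ t)) :* (con ½ :+ t)))
         := (con (- (+ 1 / 4)) :* e)
            :* (((p :* (con 1ℚ :+ t)) :* ((p :* (con 1ℚ :+ t)) :* ((p :* (con 1ℚ :+ t)) :* con 1ℚ))) :* (h :* (con ½ :+ t))))
         refl ((- (+ 1 / 4)) ^ k) (poch 1ℚ k) (poch ½ k) t ⟩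
  (- (+ 1 / 4)) ^ suc k * num (suc k) ∎
  where
  open ≡-Reasoning
  t E b₂ b₃ y₂ y₃ ρ T : ℚ
  t  = fromℕ k
  E  = ∏b 0 (2 ℕ.+ 2 ℕ.* k)
  b₂ = b (2 ℕ.+ 2 ℕ.* k ℕ.+ 0)
  b₃ = b (3 ℕ.+ 2 ℕ.* k ℕ.+ 0)
  y₂ = o 0 + fromℕ 2 * (fromℕ 2 + fromℕ 2 * t)
  y₃ = o 0 + fromℕ 2 * (fromℕ 3 + fromℕ 2 * t)
  ρ  = - (+ 1 / 4) * ((1ℚ + t) * ((1ℚ + t) * (1ℚ + t)) * (½ + t))
  T  = (+ 1 / 8) * (±1 k * C k) * E

-- Unfolds to the term in the theorem, so that results about `summand` apply there by definition.
summand : ℕ → ℚ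
summand k =
  (- (+ 1 / 4)) ^ k
  * (num k ÷ den k) {{denominator≢0 k}}
  * ((fromℕ 19 + fromℕ 56 * fromℕ k + fromℕ 40 * fromℕ k ^ 2)
      * (H⁽²⁾ k + H⁽²⁾ (1 ℕ.+ 2 ℕ.* k) - fromℕ 4 * H⁽²⁾ (3 ℕ.+ 4 ℕ.* k))
    + fromℕ 4)

-- As `q 0 k` is half of the quadratic polynomial and the harmonic bracket is - 4 `L`, the braces
-- equal - 8 (q L - ½). This accounts for the 1/8 in `coeff-den` and for the minus sign in `c`.
summand≡G₀ : ∀ k → summand k ≡ G 0 k
summand≡G₀ k = begin
  summand k
    ≡⟨ cong₂ (λ u v → u * ((fromℕ 19 + fromℕ 56 * t + fromℕ 40 * t ^ 2) * v + fromℕ 4)) coeff≡T (H⁽²⁾-bracket k) ⟩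
  T * ((fromℕ 19 + fromℕ 56 * t + fromℕ 40 * t ^ 2) * (- fromℕ 4 * ℓ) + fromℕ 4)
    ≡⟨ solve 5 (λ s C E ℓ t →
         con (+ 1 / 8) :* (s :* C) :* E
           :* ((con (fromℕ 19) :+ con (fromℕ 56) :* t :+ con (fromℕ 40) :* (t :* (t :* con 1ℚ)))
                 :* ((:- con (fromℕ 4)) :* ℓ) :+ con (fromℕ 4))
         := con 1ℚ :* (:- (s :* C)) :* E
           :* ((con ½ :* (con 1ℚ :* con 1ℚ :+ con (fromℕ 6) :* (con 1ℚ :+ con (fromℕ 2) :* t) :* con 1ℚ
                 :+ con (fromℕ 2) :* (con 1ℚ :+ con (fromℕ 2) :* t) :* (con (fromℕ 6) :+ con (fromℕ 10) :* t)))
               :* ℓ :- con ½))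
         refl (±1 k) (C k) E ℓ t ⟩
  G 0 k ∎
  where
  open ≡-Reasoning
  t E ℓ T den⁻¹ : ℚ
  t = fromℕ k
  E = ∏b 0 (2 ℕ.+ 2 ℕ.* k)
  ℓ = L 0 (2 ℕ.+ 2 ℕ.* k) k
  T = (+ 1 / 8) * (±1 k * C k) * E
  den⁻¹ = (1/ den k) {{denominator≢0 k}}
  coeff≡T : (- (+ 1 / 4)) ^ k * (num k ÷ den k) {{denominator≢0 k}} ≡ T
  coeff≡T = begin
    (- (+ 1 / 4)) ^ k * (num k * den⁻¹)      ≡⟨ *-assoc ((- (+ 1 / 4)) ^ k) (num k) den⁻¹ ⟨
    ((- (+ 1 / 4)) ^ k * num k) * den⁻¹      ≡⟨ cong (_* den⁻¹) (coeff-den k) ⟨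
    T * den k * den⁻¹                        ≡⟨ *-assoc T (den k) den⁻¹ ⟩
    T * (den k * den⁻¹)                      ≡⟨ *-unitʳ T (*-inverseʳ (den k) {{denominator≢0 k}}) ⟩
    T                                        ∎

-- Estimates

0≤+ : ∀ {p q} → 0ℚ ≤ p → 0ℚ ≤ q → 0ℚ ≤ p + q
0≤+ = +-mono-≤

0≤* : ∀ {p q} → 0ℚ ≤ p → 0ℚ ≤ q → 0ℚ ≤ p * q
0≤* {p} {q} 0≤p 0≤q = nonNegative⁻¹ (p * q)
  {{nonNeg*nonNeg⇒nonNeg p {{nonNegative 0≤p}} q {{nonNegative 0≤q}}}}

*-mono-≤₀ : ∀ {p p′ q q′} → 0ℚ ≤ p → 0ℚ ≤ q′ → p ≤ p′ → q ≤ q′ → p * q ≤ p′ * q′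
*-mono-≤₀ {p} {q′ = q′} 0≤p 0≤q′ p≤p′ q≤q′ =
  ≤-trans (*-monoˡ-≤-nonNeg p {{nonNegative 0≤p}} q≤q′) (*-monoʳ-≤-nonNeg q′ {{nonNegative 0≤q′}} p≤p′)

*-monoˡ-≤₀ : ∀ {r p q} → 0ℚ ≤ r → p ≤ q → r * p ≤ r * q
*-monoˡ-≤₀ {r} 0≤r = *-monoˡ-≤-nonNeg r {{nonNegative 0≤r}}

*-monoʳ-≤₀ : ∀ {r p q} → 0ℚ ≤ r → p ≤ q → p * r ≤ q * r
*-monoʳ-≤₀ {r} 0≤r = *-monoʳ-≤-nonNeg r {{nonNegative 0≤r}}

-- Reduces an inequality to a polynomial identity with an explicit nonnegative remainder, which the
-- ring solver can check.
+-excess : ∀ {p q r} → 0ℚ ≤ r → q ≡ p + r → p ≤ q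
+-excess {p} {q} {r} 0≤r refl = subst (_≤ p + r) (+-identityʳ p) (+-monoʳ-≤ p 0≤r)

0≤fromℕ : ∀ n → 0ℚ ≤ fromℕ n
0≤fromℕ n = nonNegative⁻¹ (fromℕ n) {{fromℕ-nonNeg n}}

0≤1+fromℕ : ∀ n → 0ℚ ≤ 1ℚ + fromℕ n
0≤1+fromℕ n = 0≤+ (0≤fromℕ 1) (0≤fromℕ n)

0≤1+2fromℕ : ∀ n → 0ℚ ≤ 1ℚ + fromℕ 2 * fromℕ n
0≤1+2fromℕ n = 0≤+ (0≤fromℕ 1) (0≤* (0≤fromℕ 2) (0≤fromℕ n))

fromℕ-mono : ∀ {m n} → m ℕ.≤ n → fromℕ m ≤ fromℕ n
fromℕ-mono {m} {n} m≤n = +-excess (0≤fromℕ (n ℕ.∸ m))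
  (trans (cong fromℕ (sym (ℕ.m+[n∸m]≡n m≤n))) (fromℕ-+ m (n ℕ.∸ m)))

0≤inv : ∀ n → 0ℚ ≤ inv n
0≤inv n = <⇒≤ (positive⁻¹ (inv n) {{normalize-pos 1 (suc n)}})

inv-antitone : ∀ {m n} → m ℕ.≤ n → inv n ≤ inv m
inv-antitone {m} {n} m≤n = begin
  inv n                               ≡⟨ *-unitʳ (inv n) (inv*suc m) ⟨
  inv n * (inv m * (1ℚ + fromℕ m))    ≤⟨ *-monoˡ-≤₀ (0≤inv n) (*-monoˡ-≤₀ (0≤inv m) (+-monoʳ-≤ 1ℚ (fromℕ-mono m≤n))) ⟩
  inv n * (inv m * (1ℚ + fromℕ n))    ≡⟨ solve 3 (λ i j x → i :* (j :* x) := j :* (i :* x)) refl (inv n) (inv m) (1ℚ + fromℕ n) ⟩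
  inv m * (inv n * (1ℚ + fromℕ n))    ≡⟨ *-unitʳ (inv m) (inv*suc n) ⟩
  inv m                               ∎
  where open ≤-Reasoning

0≤b : ∀ n → 0ℚ ≤ b n
0≤b n = 0≤* (0≤inv (2 ℕ.* n)) (0≤inv (2 ℕ.* n))

b-antitone : ∀ {m n} → m ℕ.≤ n → b n ≤ b m
b-antitone {m} {n} m≤n = *-mono-≤₀ (0≤inv (2 ℕ.* n)) (0≤inv (2 ℕ.* m)) w≤ w≤
  where
  w≤ : w n ≤ w m
  w≤ = inv-antitone (ℕ.*-monoʳ-≤ 2 m≤n)

b≤1 : ∀ n → b n ≤ 1ℚ
b≤1 n = b-antitone {0} {n} ℕ.z≤n

b≤inv : ∀ {m n} → m ℕ.≤ n → b n ≤ inv m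
b≤inv {m} {n} m≤n = begin
  w n * w n    ≤⟨ *-monoˡ-≤₀ (0≤inv (2 ℕ.* n)) (inv-antitone {0} {2 ℕ.* n} ℕ.z≤n) ⟩
  w n * 1ℚ     ≡⟨ *-identityʳ (w n) ⟩
  w n          ≤⟨ inv-antitone (ℕ.≤-trans m≤n (ℕ.m≤m+n n (n ℕ.+ 0))) ⟩
  inv m        ∎
  where open ≤-Reasoning

0≤∏b : ∀ n l → 0ℚ ≤ ∏b n l
0≤∏b n zero    = 0≤fromℕ 1
0≤∏b n (suc l) = 0≤* (0≤∏b n l) (0≤b (l ℕ.+ n))

∏b≤1 : ∀ n l → ∏b n l ≤ 1ℚ
∏b≤1 n zero    = ≤-refl
∏b≤1 n (suc l) = *-mono-≤₀ (0≤∏b n l) (0≤fromℕ 1) (∏b≤1 n l) (b≤1 (l ℕ.+ n))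

∏b-antitone : ∀ {m n} → m ℕ.≤ n → ∀ l → ∏b n l ≤ ∏b m l
∏b-antitone m≤n zero = ≤-refl
∏b-antitone {m} {n} m≤n (suc l) = *-mono-≤₀ (0≤∏b n l) (0≤b (l ℕ.+ m))
  (∏b-antitone m≤n l) (b-antitone (ℕ.+-monoʳ-≤ l m≤n))

∑<-nonNeg : ∀ {f} → (∀ n → 0ℚ ≤ f n) → ∀ n → 0ℚ ≤ ∑< n f
∑<-nonNeg 0≤f zero    = ≤-refl
∑<-nonNeg 0≤f (suc n) = 0≤+ (∑<-nonNeg 0≤f n) (0≤f n)

∑<-≤-fromℕ : ∀ {f} → (∀ n → f n ≤ 1ℚ) → ∀ n → ∑< n f ≤ fromℕ n
∑<-≤-fromℕ f≤1 zero    = ≤-refl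
∑<-≤-fromℕ {f} f≤1 (suc n) = begin
  ∑< n f + f n      ≤⟨ +-mono-≤ (∑<-≤-fromℕ f≤1 n) (f≤1 n) ⟩
  fromℕ n + 1ℚ      ≡⟨ +-comm (fromℕ n) 1ℚ ⟩
  1ℚ + fromℕ n      ≡⟨ fromℕ-suc n ⟨
  fromℕ (suc n)     ∎
  where open ≤-Reasoning

∣∑<∣≤ : ∀ {f g} → (∀ n → ∣ f n ∣ ≤ g n) → ∀ n → ∣ ∑< n f ∣ ≤ ∑< n g
∣∑<∣≤ ∣f∣≤g zero = ≤-refl
∣∑<∣≤ {f} ∣f∣≤g (suc n) =
  ≤-trans (∣p+q∣≤∣p∣+∣q∣ (∑< n f) (f n)) (+-mono-≤ (∣∑<∣≤ ∣f∣≤g n) (∣f∣≤g n))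

-- Telescoping, as b n ≤ 2 / ((n + 1) (n + 2)).
∑<-b : ∀ M → ∑< M b + fromℕ 2 * inv M ≤ fromℕ 2
∑<-b zero    = ≤-refl
∑<-b (suc M) = begin
  (∑< M b + b M) + fromℕ 2 * j      ≡⟨ +-assoc (∑< M b) (b M) (fromℕ 2 * j) ⟩
  ∑< M b + (b M + fromℕ 2 * j)      ≤⟨ +-monoʳ-≤ (∑< M b) (+-excess 0≤rest step) ⟩
  ∑< M b + fromℕ 2 * i              ≤⟨ ∑<-b M ⟩
  fromℕ 2                           ∎
  where
  open ≤-Reasoning
  t i j rest : ℚ
  t = fromℕ M
  i = inv M
  j = inv (suc M)
  -- The last factor is 2 (2t + 1)² - (t + 1) (t + 2) = t (5 + 7t).
  rest = b M * (i * j * (t * (fromℕ 5 + fromℕ 7 * t)))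
  0≤rest : 0ℚ ≤ rest
  0≤rest = 0≤* (0≤b M) (0≤* (0≤* (0≤inv M) (0≤inv (suc M)))
    (0≤* (0≤fromℕ M) (0≤+ (0≤fromℕ 5) (0≤* (0≤fromℕ 7) (0≤fromℕ M)))))
  iu≡1 : i * (1ℚ + t) ≡ 1ℚ
  iu≡1 = inv*suc M
  jv≡1 : j * (fromℕ 2 + t) ≡ 1ℚ
  jv≡1 = trans (cong (j *_) (trans (solve 1 (λ t → con (fromℕ 2) :+ t := con 1ℚ :+ (con 1ℚ :+ t)) refl t)
    (cong (λ z → 1ℚ + z) (sym (fromℕ-suc M))))) (inv*suc (suc M))
  step : fromℕ 2 * i ≡ (b M + fromℕ 2 * j) + rest
  step = begin-equality
    fromℕ 2 * i
      ≡⟨ *-unitʳ (fromℕ 2 * i) jv≡1 ⟨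
    fromℕ 2 * i * (j * (fromℕ 2 + t))
      ≡⟨ solve 3 (λ i j t → con (fromℕ 2) :* i :* (j :* (con (fromℕ 2) :+ t))
                  := con (fromℕ 2) :* i :* j :* con 1ℚ :+ con (fromℕ 2) :* j :* (i :* (con 1ℚ :+ t))) refl i j t ⟩
    fromℕ 2 * i * j * 1ℚ + fromℕ 2 * j * (i * (1ℚ + t))
      ≡⟨ cong₂ (λ u v → fromℕ 2 * i * j * u + v) (sym (b*o² M)) (*-unitʳ (fromℕ 2 * j) iu≡1) ⟩
    fromℕ 2 * i * j * (b M * (o M * o M)) + fromℕ 2 * j
      ≡⟨ solve 4 (λ i j t b → con (fromℕ 2) :* i :* j
                    :* (b :* ((con 1ℚ :+ con (fromℕ 2) :* t) :* (con 1ℚ :+ con (fromℕ 2) :* t))) :+ con (fromℕ 2) :* j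
                  := (b :* ((i :* (con 1ℚ :+ t)) :* (j :* (con (fromℕ 2) :+ t))) :+ con (fromℕ 2) :* j)
                     :+ b :* (i :* j :* (t :* (con (fromℕ 5) :+ con (fromℕ 7) :* t)))) refl i j t (b M) ⟩
    (b M * ((i * (1ℚ + t)) * (j * (fromℕ 2 + t))) + fromℕ 2 * j) + rest
      ≡⟨ cong (λ z → (z + fromℕ 2 * j) + rest) (*-unitʳ (b M) (cong₂ _*_ iu≡1 jv≡1)) ⟩
    (b M + fromℕ 2 * j) + rest ∎

∑<-b≤2 : ∀ M → ∑< M b ≤ fromℕ 2
∑<-b≤2 M = ≤-trans (+-excess (0≤* (0≤fromℕ 2) (0≤inv M)) refl) (∑<-b M)

-- The edge k = K, bounded uniformly in M

0≤ratio : ∀ k → 0ℚ ≤ ratio k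
0≤ratio k = 0≤* (0≤* (0≤fromℕ 32) (0≤* 0≤u (0≤* 0≤u 0≤u))) (0≤1+2fromℕ k)
  where 0≤u = 0≤1+fromℕ k

0≤C : ∀ k → 0ℚ ≤ C k
0≤C zero    = 0≤fromℕ 72
0≤C (suc k) = 0≤* (0≤ratio k) (0≤C k)

-- Successive values of `C k * ∏b 1 (2 ℕ.* k)` have a quotient tending to 1/4, so quadratic decay
-- survives induction. Of the two factors 1 + k, one will pay for the growth of `L` and the other
-- gives convergence to 0.
C∏b-decay : ∀ k → C k * ∏b 1 (2 ℕ.* k) * ((1ℚ + fromℕ k) * (1ℚ + fromℕ k)) ≤ fromℕ 72
C∏b-decay zero    = ≤-refl
C∏b-decay (suc k) = begin
  ratio k * C k * ∏b 1 (2 ℕ.* suc k) * ((1ℚ + fromℕ (suc k)) * (1ℚ + fromℕ (suc k)))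
    ≡⟨ cong₂ (λ l t → ratio k * C k * ∏b 1 l * ((1ℚ + t) * (1ℚ + t))) (ℕ.*-suc 2 k) (fromℕ-suc k) ⟩
  ratio k * C k * (P * b₁ * b₂) * ((1ℚ + u) * (1ℚ + u))
    ≡⟨ solve 6 (λ r C P b₁ b₂ v → r :* C :* (P :* b₁ :* b₂) :* (v :* v)
                := C :* P :* (b₁ :* b₂ :* (r :* (v :* v)))) refl (ratio k) (C k) P b₁ b₂ (1ℚ + u) ⟩
  C k * P * (b₁ * b₂ * (ratio k * ((1ℚ + u) * (1ℚ + u))))
    ≤⟨ *-monoˡ-≤₀ (0≤* (0≤C k) (0≤∏b 1 (2 ℕ.* k))) (+-excess 0≤rest step) ⟩
  C k * P * (u * u)
    ≤⟨ C∏b-decay k ⟩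
  fromℕ 72 ∎
  where
  open ≤-Reasoning
  t u P b₁ b₂ y₁ y₂ rest : ℚ
  t = fromℕ k
  u = 1ℚ + t
  P = ∏b 1 (2 ℕ.* k)
  b₁ = b (2 ℕ.* k ℕ.+ 1)
  b₂ = b (1 ℕ.+ 2 ℕ.* k ℕ.+ 1)
  y₁ = o 1 + fromℕ 2 * (fromℕ 0 + fromℕ 2 * t)
  y₂ = o 1 + fromℕ 2 * (fromℕ 1 + fromℕ 2 * t)
  -- The polynomial is (4t + 3)² (4t + 5)² - 32 (1 + t) (1 + 2t) (2 + t)², in Horner form; all its
  -- coefficients are positive.
  rest = b₁ * b₂ * (u * u * (fromℕ 97 + t * (fromℕ 448 + t * (fromℕ 832 + t * (fromℕ 672 + t * fromℕ 192)))))
  0≤t : 0ℚ ≤ t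
  0≤t = 0≤fromℕ k
  0≤rest : 0ℚ ≤ rest
  0≤rest = 0≤* (0≤* (0≤b (2 ℕ.* k ℕ.+ 1)) (0≤b (1 ℕ.+ 2 ℕ.* k ℕ.+ 1)))
    (0≤* (0≤* (0≤1+fromℕ k) (0≤1+fromℕ k))
      (0≤+ (0≤fromℕ 97) (0≤* 0≤t (0≤+ (0≤fromℕ 448) (0≤* 0≤t (0≤+ (0≤fromℕ 832) (0≤* 0≤t
        (0≤+ (0≤fromℕ 672) (0≤* 0≤t (0≤fromℕ 192))))))))))
  step : u * u ≡ b₁ * b₂ * (ratio k * ((1ℚ + u) * (1ℚ + u))) + rest
  step = begin-equality
    u * u
      ≡⟨ *-unitʳ (u * u) (cong₂ _*_ (b*o²-shift 0 k 1) (b*o²-shift 1 k 1)) ⟨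
    u * u * ((b₁ * (y₁ * y₁)) * (b₂ * (y₂ * y₂)))
      ≡⟨ solve 3 (λ t b₁ b₂ →
           let u = con 1ℚ :+ t
               y₁ = con (o 1) :+ con (fromℕ 2) :* (con (fromℕ 0) :+ con (fromℕ 2) :* t)
               y₂ = con (o 1) :+ con (fromℕ 2) :* (con (fromℕ 1) :+ con (fromℕ 2) :* t)
           in u :* u :* ((b₁ :* (y₁ :* y₁)) :* (b₂ :* (y₂ :* y₂)))
              := b₁ :* b₂ :* (con (fromℕ 32) :* (u :* (u :* u)) :* (con 1ℚ :+ con (fromℕ 2) :* t)
                   :* ((con 1ℚ :+ u) :* (con 1ℚ :+ u)))
                 :+ b₁ :* b₂ :* (u :* u :* (con (fromℕ 97) :+ t :* (con (fromℕ 448) :+ t :* (con (fromℕ 832)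
                      :+ t :* (con (fromℕ 672) :+ t :* con (fromℕ 192)))))))
           refl t b₁ b₂ ⟩
    b₁ * b₂ * (ratio k * ((1ℚ + u) * (1ℚ + u))) + rest ∎

∣±1∣≡1 : ∀ n → ∣ ±1 n ∣ ≡ 1ℚ
∣±1∣≡1 zero    = refl
∣±1∣≡1 (suc n) = trans (∣p*q∣≡∣p∣*∣q∣ (- 1ℚ) (±1 n)) (cong (1ℚ *_) (∣±1∣≡1 n))

∣±1*c∣≡C : ∀ n k → ∣ ±1 n * c k ∣ ≡ C k
∣±1*c∣≡C n k = begin
  ∣ ±1 n * - (±1 k * C k) ∣         ≡⟨ ∣p*q∣≡∣p∣*∣q∣ (±1 n) (c k) ⟩
  ∣ ±1 n ∣ * ∣ - (±1 k * C k) ∣     ≡⟨ cong₂ _*_ (∣±1∣≡1 n) (∣-p∣≡∣p∣ (±1 k * C k)) ⟩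
  1ℚ * ∣ ±1 k * C k ∣               ≡⟨ *-identityˡ ∣ ±1 k * C k ∣ ⟩
  ∣ ±1 k * C k ∣                    ≡⟨ ∣p*q∣≡∣p∣*∣q∣ (±1 k) (C k) ⟩
  ∣ ±1 k ∣ * ∣ C k ∣                ≡⟨ cong₂ _*_ (∣±1∣≡1 k) (0≤p⇒∣p∣≡p (0≤C k)) ⟩
  1ℚ * C k                          ≡⟨ *-identityˡ (C k) ⟩
  C k                               ∎
  where open ≡-Reasoning

∣±1*c*∏b*z∣ : ∀ n k l z → ∣ ±1 n * c k * ∏b n l * z ∣ ≡ C k * ∏b n l * ∣ z ∣
∣±1*c*∏b*z∣ n k l z = begin
  ∣ ±1 n * c k * ∏b n l * z ∣             ≡⟨ ∣p*q∣≡∣p∣*∣q∣ (±1 n * c k * ∏b n l) z ⟩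
  ∣ ±1 n * c k * ∏b n l ∣ * ∣ z ∣         ≡⟨ cong (_* ∣ z ∣) (∣p*q∣≡∣p∣*∣q∣ (±1 n * c k) (∏b n l)) ⟩
  ∣ ±1 n * c k ∣ * ∣ ∏b n l ∣ * ∣ z ∣     ≡⟨ cong₂ (λ u v → u * v * ∣ z ∣) (∣±1*c∣≡C n k) (0≤p⇒∣p∣≡p (0≤∏b n l)) ⟩
  C k * ∏b n l * ∣ z ∣                    ∎
  where open ≡-Reasoning

-- Every term of both sums is at most 1, and there are at most 2 + 2k and k of them. The bound on
-- `l` covers the windows of both `F` and `G`.
∣L∣≤ : ∀ n {l} k → l ℕ.≤ 2 ℕ.+ 2 ℕ.* k → ∣ L n l k ∣ ≤ fromℕ 3 * (1ℚ + fromℕ k)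
∣L∣≤ n {l} k l≤2+2k = begin
  ∣ ∑b n l - (+ 1 / 4) * H⁽²⁾ k ∣
    ≤⟨ ∣p-q∣≤∣p∣+∣q∣ (∑b n l) ((+ 1 / 4) * H⁽²⁾ k) ⟩
  ∣ ∑b n l ∣ + ∣ (+ 1 / 4) * H⁽²⁾ k ∣
    ≡⟨ cong₂ _+_ (0≤p⇒∣p∣≡p (∑<-nonNeg (λ i → 0≤b (i ℕ.+ n)) l)) (0≤p⇒∣p∣≡p (0≤* 0≤¼ 0≤H)) ⟩
  ∑b n l + (+ 1 / 4) * H⁽²⁾ k
    ≤⟨ +-mono-≤ (≤-trans (∑<-≤-fromℕ (λ i → b≤1 (i ℕ.+ n)) l) (fromℕ-mono l≤2+2k))
                (*-mono-≤₀ 0≤¼ (0≤fromℕ k) (+-excess {r = + 3 / 4} (nonNegative⁻¹ (+ 3 / 4)) refl)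
                   (∑<-≤-fromℕ inv²≤1 k)) ⟩
  fromℕ (2 ℕ.+ 2 ℕ.* k) + 1ℚ * fromℕ k
    ≡⟨ cong (_+ 1ℚ * fromℕ k) (trans (fromℕ-+ 2 (2 ℕ.* k)) (cong (λ z → fromℕ 2 + z) (fromℕ-2* k))) ⟩
  (fromℕ 2 + fromℕ 2 * fromℕ k) + 1ℚ * fromℕ k
    ≤⟨ +-excess (0≤fromℕ 1) (solve 1 (λ t → con (fromℕ 3) :* (con 1ℚ :+ t)
         := ((con (fromℕ 2) :+ con (fromℕ 2) :* t) :+ con 1ℚ :* t) :+ con 1ℚ) refl (fromℕ k)) ⟩
  fromℕ 3 * (1ℚ + fromℕ k) ∎
  where
  open ≤-Reasoning
  0≤¼ : 0ℚ ≤ + 1 / 4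
  0≤¼ = nonNegative⁻¹ (+ 1 / 4)
  0≤inv² : ∀ i → 0ℚ ≤ inv i ^ 2
  0≤inv² i = 0≤* (0≤inv i) (0≤* (0≤inv i) (0≤fromℕ 1))
  inv≤1 : ∀ i → inv i ≤ 1ℚ
  inv≤1 i = inv-antitone {0} {i} ℕ.z≤n
  inv²≤1 : ∀ i → inv i ^ 2 ≤ 1ℚ
  inv²≤1 i = *-mono-≤₀ {q′ = 1ℚ} (0≤inv i) (0≤fromℕ 1) (inv≤1 i)
    (*-mono-≤₀ {q′ = 1ℚ} (0≤inv i) (0≤fromℕ 1) (inv≤1 i) ≤-refl)
  0≤H : 0ℚ ≤ H⁽²⁾ k
  0≤H = ∑<-nonNeg 0≤inv² k

-- The first factor `b n` is kept for summing over n. The rest of the window is largest at n = 0,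
-- where `C∏b-decay` applies; 216 is 3 · 72.
∣F∣≤ : ∀ k n → ∣ F n k ∣ ≤ fromℕ 216 * inv k * b n
∣F∣≤ k n = begin
  ∣ F n k ∣
    ≡⟨ ∣±1*c*∏b*z∣ n k (1 ℕ.+ 2 ℕ.* k) (L n (1 ℕ.+ 2 ℕ.* k) k) ⟩
  C k * ∏b n (1 ℕ.+ 2 ℕ.* k) * ∣ L n (1 ℕ.+ 2 ℕ.* k) k ∣
    ≡⟨ cong (λ z → C k * z * ∣ L n (1 ℕ.+ 2 ℕ.* k) k ∣) (∏b-front n (2 ℕ.* k)) ⟩
  C k * (b n * ∏b (suc n) (2 ℕ.* k)) * ∣ L n (1 ℕ.+ 2 ℕ.* k) k ∣
    ≤⟨ *-mono-≤₀ (0≤* (0≤C k) (0≤* (0≤b n) (0≤∏b (suc n) (2 ℕ.* k)))) (0≤* (0≤fromℕ 3) (0≤1+fromℕ k))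
         (*-monoˡ-≤₀ (0≤C k) (*-monoˡ-≤₀ (0≤b n) (∏b-antitone (ℕ.s≤s ℕ.z≤n) (2 ℕ.* k))))
         (∣L∣≤ n k (ℕ.n≤1+n (1 ℕ.+ 2 ℕ.* k))) ⟩
  C k * (b n * P) * (fromℕ 3 * u)
    ≡⟨ *-unitʳ (C k * (b n * P) * (fromℕ 3 * u)) (inv*suc k) ⟨
  C k * (b n * P) * (fromℕ 3 * u) * (inv k * u)
    ≡⟨ solve 5 (λ C b P u i → C :* (b :* P) :* (con (fromℕ 3) :* u) :* (i :* u)
                := con (fromℕ 3) :* i :* b :* (C :* P :* (u :* u))) refl (C k) (b n) P u (inv k) ⟩
  fromℕ 3 * inv k * b n * (C k * P * (u * u))
    ≤⟨ *-monoˡ-≤₀ (0≤* (0≤* (0≤fromℕ 3) (0≤inv k)) (0≤b n)) (C∏b-decay k) ⟩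
  fromℕ 3 * inv k * b n * fromℕ 72
    ≡⟨ solve 2 (λ i b → con (fromℕ 3) :* i :* b :* con (fromℕ 72) := con (fromℕ 216) :* i :* b) refl (inv k) (b n) ⟩
  fromℕ 216 * inv k * b n ∎
  where
  open ≤-Reasoning
  P = ∏b 1 (2 ℕ.* k)
  u = 1ℚ + fromℕ k

∣∑F∣≤ : ∀ M k → ∣ ∑< M (λ n → F n k) ∣ ≤ fromℕ 432 * inv k
∣∑F∣≤ M k = begin
  ∣ ∑< M (λ n → F n k) ∣                     ≤⟨ ∣∑<∣≤ (∣F∣≤ k) M ⟩
  ∑< M (λ n → fromℕ 216 * inv k * b n)       ≡⟨ ∑<-*ˡ (fromℕ 216 * inv k) b M ⟩
  fromℕ 216 * inv k * ∑< M b                 ≤⟨ *-monoˡ-≤₀ (0≤* (0≤fromℕ 216) (0≤inv k)) (∑<-b≤2 M) ⟩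
  fromℕ 216 * inv k * fromℕ 2                ≡⟨ solve 1 (λ i → con (fromℕ 216) :* i :* con (fromℕ 2) := con (fromℕ 432) :* i) refl (inv k) ⟩
  fromℕ 432 * inv k                          ∎
  where open ≤-Reasoning

-- The edge n = M, bounded for each fixed K

B : ℕ → ℚ
B k = C k * (q 0 k * (fromℕ 3 * (1ℚ + fromℕ k)) + ½)

0≤q : ∀ n k → 0ℚ ≤ q n k
0≤q n k = 0≤* (nonNegative⁻¹ ½) (0≤+ (0≤+ (0≤* 0≤o 0≤o) (0≤* (0≤* (0≤fromℕ 6) (0≤1+2fromℕ k)) 0≤o))
  (0≤* (0≤* (0≤fromℕ 2) (0≤1+2fromℕ k)) (0≤+ (0≤fromℕ 6) (0≤* (0≤fromℕ 10) (0≤fromℕ k)))))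
  where 0≤o = 0≤1+2fromℕ n

-- `q` is quadratic in `o n`, and `b n` divides by `o n` squared. At n = 0, where `b` is 1, the two
-- sides agree.
b*q≤q₀ : ∀ n k → b n * q n k ≤ q 0 k
b*q≤q₀ n k = +-excess {r = rest} 0≤rest (trans (sym (*-unitʳ (q 0 k) (b*o² n)))
  (solve 3 (λ t m b →
    let o = con 1ℚ :+ con (fromℕ 2) :* m
        v = con 1ℚ :+ con (fromℕ 2) :* t
        q = λ x → con ½ :* (x :* x :+ con (fromℕ 6) :* v :* x
              :+ con (fromℕ 2) :* v :* (con (fromℕ 6) :+ con (fromℕ 10) :* t))
    in q (con 1ℚ) :* (b :* (o :* o))
       := b :* q o :+ b :* (v :* m :* (con (fromℕ 6) :* o
              :+ con (fromℕ 4) :* (con 1ℚ :+ m) :* (con (fromℕ 6) :+ con (fromℕ 10) :* t))))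
    refl (fromℕ k) (fromℕ n) (b n)))
  where
  rest = b n * ((1ℚ + fromℕ 2 * fromℕ k) * fromℕ n * (fromℕ 6 * o n
           + fromℕ 4 * (1ℚ + fromℕ n) * (fromℕ 6 + fromℕ 10 * fromℕ k)))
  0≤rest : 0ℚ ≤ rest
  0≤rest = 0≤* (0≤b n) (0≤* (0≤* (0≤1+2fromℕ k) (0≤fromℕ n)) (0≤+ (0≤* (0≤fromℕ 6) (0≤1+2fromℕ n))
    (0≤* (0≤* (0≤fromℕ 4) (0≤1+fromℕ n)) (0≤+ (0≤fromℕ 6) (0≤* (0≤fromℕ 10) (0≤fromℕ k))))))

-- Of the window, which has length at least two, the first factor is kept to compensate the growth
-- of `q` in n, and the last one supplies the decay 1/(n + 1).
∏b≤b*inv : ∀ n l → ∏b n (2 ℕ.+ l) ≤ b n * inv n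
∏b≤b*inv n l = begin
  ∏b n (1 ℕ.+ l) * b (1 ℕ.+ l ℕ.+ n)         ≡⟨ cong (_* b (1 ℕ.+ l ℕ.+ n)) (∏b-front n l) ⟩
  b n * ∏b (suc n) l * b (1 ℕ.+ l ℕ.+ n)     ≤⟨ *-mono-≤₀ (0≤* (0≤b n) (0≤∏b (suc n) l)) (0≤inv n)
                                                  (*-monoˡ-≤₀ (0≤b n) (∏b≤1 (suc n) l)) (b≤inv (ℕ.m≤n+m n (1 ℕ.+ l))) ⟩
  b n * 1ℚ * inv n                           ≡⟨ cong (_* inv n) (*-identityʳ (b n)) ⟩
  b n * inv n                                ∎
  where open ≤-Reasoning

∣G∣≤ : ∀ n k → ∣ G n k ∣ ≤ inv n * B k
∣G∣≤ n k = begin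
  ∣ G n k ∣
    ≡⟨ ∣±1*c*∏b*z∣ n k (2 ℕ.+ 2 ℕ.* k) (q n k * ℓ - ½) ⟩
  C k * ∏b n (2 ℕ.+ 2 ℕ.* k) * ∣ q n k * ℓ - ½ ∣
    ≤⟨ *-mono-≤₀ (0≤* (0≤C k) (0≤∏b n (2 ℕ.+ 2 ℕ.* k))) (0≤+ (0≤* (0≤q n k) 0≤v) (nonNegative⁻¹ ½))
         (*-monoˡ-≤₀ (0≤C k) (∏b≤b*inv n (2 ℕ.* k))) ∣qℓ-½∣≤ ⟩
  C k * (b n * inv n) * (q n k * v + ½)
    ≡⟨ solve 5 (λ C b i q v → C :* (b :* i) :* (q :* v :+ con ½) := C :* i :* ((b :* q) :* v :+ b :* con ½))
         refl (C k) (b n) (inv n) (q n k) v ⟩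
  C k * inv n * ((b n * q n k) * v + b n * ½)
    ≤⟨ *-monoˡ-≤₀ (0≤* (0≤C k) (0≤inv n))
         (+-mono-≤ (*-monoʳ-≤₀ 0≤v (b*q≤q₀ n k)) (*-monoʳ-≤₀ (nonNegative⁻¹ ½) (b≤1 n))) ⟩
  C k * inv n * (q 0 k * v + 1ℚ * ½)
    ≡⟨ solve 4 (λ C i q v → C :* i :* (q :* v :+ con 1ℚ :* con ½) := i :* (C :* (q :* v :+ con ½)))
         refl (C k) (inv n) (q 0 k) v ⟩
  inv n * B k ∎
  where
  open ≤-Reasoning
  ℓ = L n (2 ℕ.+ 2 ℕ.* k) k
  v = fromℕ 3 * (1ℚ + fromℕ k)
  0≤v : 0ℚ ≤ v
  0≤v = 0≤* (0≤fromℕ 3) (0≤1+fromℕ k)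
  ∣qℓ-½∣≤ : ∣ q n k * ℓ - ½ ∣ ≤ q n k * v + ½
  ∣qℓ-½∣≤ = begin
    ∣ q n k * ℓ - ½ ∣           ≤⟨ ∣p-q∣≤∣p∣+∣q∣ (q n k * ℓ) ½ ⟩
    ∣ q n k * ℓ ∣ + ½           ≡⟨ cong (_+ ½) (∣p*q∣≡∣p∣*∣q∣ (q n k) ℓ) ⟩
    ∣ q n k ∣ * ∣ ℓ ∣ + ½       ≡⟨ cong (λ z → z * ∣ ℓ ∣ + ½) (0≤p⇒∣p∣≡p (0≤q n k)) ⟩
    q n k * ∣ ℓ ∣ + ½           ≤⟨ +-monoˡ-≤ ½ (*-monoˡ-≤₀ (0≤q n k) (∣L∣≤ n k ℕ.≤-refl)) ⟩
    q n k * v + ½               ∎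

∣∑G∣≤ : ∀ M K → ∣ ∑< K (G M) ∣ ≤ ∑< K B * inv M
∣∑G∣≤ M K = begin
  ∣ ∑< K (G M) ∣                 ≤⟨ ∣∑<∣≤ (∣G∣≤ M) K ⟩
  ∑< K (λ k → inv M * B k)       ≡⟨ ∑<-*ˡ (inv M) B K ⟩
  inv M * ∑< K B                 ≡⟨ *-comm (inv M) (∑< K B) ⟩
  ∑< K B * inv M                 ∎
  where open ≤-Reasoning

-- Passage to the limit

archimedean : ∀ p → ∃[ N ] p ≤ fromℕ N
-- The numerator is an upper bound because the denominator is at least 1.
archimedean p@(mkℚ (+ a) d _) = a , toℚᵘ-cancel-≤ (begin
  toℚᵘ p                  ≤⟨ ℚᵘ.*≤* (ℤ.*-monoˡ-≤-nonNeg (+ a) (ℤ.+≤+ (ℕ.s≤s {0} {d} ℕ.z≤n))) ⟩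
  ℚᵘ.mkℚᵘ (+ a) 0         ≃⟨ toℚᵘ-fromℚᵘ (ℚᵘ.mkℚᵘ (+ a) 0) ⟨
  toℚᵘ (fromℕ a)          ∎)
  where open ℚᵘ.≤-Reasoning
archimedean p@(mkℚ ℤ.-[1+ _ ] _ _) = 0 , <⇒≤ (negative⁻¹ p)

*-inv-eventually-≤ : ∀ p ε → 0ℚ < ε → ∃[ N ] (∀ n → N ℕ.≤ n → p * inv n ≤ ε)
*-inv-eventually-≤ p ε 0<ε = N , λ n N≤n → begin
  p * inv n                                      ≡⟨ cong (_* inv n) p≡ ⟩
  (p * ε⁻¹) * ε * inv n                          ≤⟨ *-monoʳ-≤₀ (0≤inv n) (*-monoʳ-≤₀ (<⇒≤ 0<ε) (p/ε≤1+n n N≤n)) ⟩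
  (1ℚ + fromℕ n) * ε * inv n                     ≡⟨ solve 3 (λ x e i → x :* e :* i := e :* (i :* x)) refl (1ℚ + fromℕ n) ε (inv n) ⟩
  ε * (inv n * (1ℚ + fromℕ n))                   ≡⟨ *-unitʳ ε (inv*suc n) ⟩
  ε                                              ∎
  where
  open ≤-Reasoning
  instance
    ε≢0 : NonZero ε
    ε≢0 = pos⇒nonZero ε {{positive 0<ε}}
  ε⁻¹ = 1/ ε
  N = proj₁ (archimedean (p * ε⁻¹))
  p≡ : p ≡ (p * ε⁻¹) * ε
  p≡ = sym (trans (*-assoc p ε⁻¹ ε) (*-unitʳ p (*-inverseˡ ε)))
  p/ε≤1+n : ∀ n → N ℕ.≤ n → p * ε⁻¹ ≤ 1ℚ + fromℕ n
  p/ε≤1+n n N≤n = ≤-trans (proj₂ (archimedean (p * ε⁻¹)))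
    (≤-trans (fromℕ-mono N≤n) (+-excess (0≤fromℕ 1) (+-comm 1ℚ (fromℕ n))))

-- Rearranges `∑F-∑G`: the distance between the two partial sums is carried by the two far edges of
-- the rectangle.
remainder : ∀ K M → ∑< K summand + (- 1ℚ) * ((- fromℕ 72) * ∑< M β4-term)
                  ≡ ∑< K (G M) - ∑< M (λ n → F n K)
remainder K M = begin
  ∑< K summand + (- 1ℚ) * ((- fromℕ 72) * ∑< M β4-term)
    ≡⟨ cong₂ (λ u v → u + (- 1ℚ) * v) (∑<-cong summand≡G₀ K)
         (sym (trans (∑<-cong F₀≡β4-term M) (∑<-*ˡ (- fromℕ 72) β4-term M))) ⟩
  a + (- 1ℚ) * d
    ≡⟨ solve 3 (λ a d f → a :+ (:- con 1ℚ) :* d := (f :+ a) :- d :- f) refl a d f ⟩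
  (f + a) - d - f
    ≡⟨ cong (λ z → z - d - f) (∑F-∑G M K) ⟩
  (d + g) - d - f
    ≡⟨ solve 3 (λ d f g → (d :+ g) :- d :- f := g :- f) refl d f g ⟩
  g - f ∎
  where
  open ≡-Reasoning
  a = ∑< K (G 0)
  d = ∑< M (λ n → F n 0)
  f = ∑< M (λ n → F n K)
  g = ∑< K (G M)

theorem1p4 : (λ k →
    (- (+ 1 / 4)) ^ k
    * ((poch 1ℚ k ^ 3 * poch ½ k)
    ÷ (poch (+ 5 / 4) k ^ 2 * poch (+ 7 / 4) k ^ 2)) {{denominator≢0 k}}
    * ((fromℕ 19 + fromℕ 56 * fromℕ k + fromℕ 40 * fromℕ k ^ 2)
    * (H⁽²⁾ k + H⁽²⁾ (1 ℕ.+ 2 ℕ.* k) - fromℕ 4 * H⁽²⁾ (3 ℕ.+ 4 ℕ.* k))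
    + fromℕ 4))
    SumsTo (- fromℕ 72) ·ᵣ β4
theorem1p4 ε 0<ε = proj₁ large-K , λ K N≤K δ 0<δ →
  -- The index M of the sequence representing β(4) is the cutoff in n. The edge k = K is at most ε
  -- for every M, so K is fixed first; the bound on the edge n = M depends on K and is absorbed by
  -- the slack δ of `_≤ᵣ_`.
  let large-M = *-inv-eventually-≤ (∑< K B) δ 0<δ in
  proj₁ large-M , λ M N≤M → begin
    ∣ ∑< K summand + (- 1ℚ) * ((- fromℕ 72) * ∑< M β4-term) ∣
      ≡⟨ cong ∣_∣ (remainder K M) ⟩
    ∣ ∑< K (G M) - ∑< M (λ n → F n K) ∣
      ≤⟨ ∣p-q∣≤∣p∣+∣q∣ (∑< K (G M)) (∑< M (λ n → F n K)) ⟩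
    ∣ ∑< K (G M) ∣ + ∣ ∑< M (λ n → F n K) ∣
      ≤⟨ +-mono-≤ (≤-trans (∣∑G∣≤ M K) (proj₂ large-M M N≤M)) (≤-trans (∣∑F∣≤ M K) (proj₂ large-K K N≤K)) ⟩
    δ + ε
      ≡⟨ +-comm δ ε ⟩
    ε + δ ∎
  where
  open ≤-Reasoning
  large-K = *-inv-eventually-≤ (fromℕ 432) ε 0<ε
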